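{- Let $\mathcal C$ be a closed curve and $P_1,P_2,\dots,P_N$ distinct points on $\mathcal C$ listed in cyclic order around $\mathcal C$, with the convention $P_{N+1}=P_1$ and $P_{N+2}=P_2$. Assume there are positive constants $A_0$ and $R_0$ such that (a) for all $j\in\{1,\dots,N\}$, $\frac{A_0}{2}\le\mathrm{Area}(\triangle P_jP_{j+1}P_{j+2})$; (b) for each $j\in\{1,\dots,N\}$ the points $P_j,P_{j+1},P_{j+2}$ lie on a circle of radius $\ge R_0$. Then $$N<\frac{\mathrm{Length}(\mathcal C)}{(A_0R_0)^{1/3}}.$$ -}

module Defs where

open import Algebra.Apartness.Bundles using (HeytingField; HeytingCommutativeRing)
open import Algebra.Bundles using (CommutativeRing; Semiring)
import Algebra.Apartness.Properties.HeytingCommutativeRing as HeytingProperties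
import Algebra.Definitions.RawMonoid as RawMonoidDefinitions
import Algebra.Definitions.RawSemiring as RawSemiringDefinitions
import Algebra.Properties.Ring as RingProperties
import Algebra.Properties.Semiring.Exp as SemiringExp
import Algebra.Solver.Ring.NaturalCoefficients.Default as SemiringSolver
open import Data.Empty using (⊥-elim)
open import Data.Fin.Base as Fin using (Fin; toℕ; inject₁; fromℕ)
open import Data.Nat.Base as ℕ using (ℕ; zero; suc; NonZero)
open import Data.Nat.DivMod using (_mod_)
import Data.Nat.Properties as ℕ
open import Data.Product.Base using (Σ; ∃-syntax; _×_; _,_; proj₁; proj₂)
open import Data.Sum.Base using (_⊎_; inj₁; inj₂)
open import Data.Unit.Polymorphic.Base using (⊤)
open import Function.Bundles using (_⇔_; Equivalence)
open import Level as L using (Level)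
open import Relation.Binary.Core using (Rel)
open import Relation.Binary.Lattice.Definitions using (Supremum)
open import Relation.Binary.PropositionalEquality.Core as ≡ using (_≢_)
import Relation.Binary.Reasoning.Base.Triple as Triple
open import Relation.Binary.Structures using (IsStrictPartialOrder; IsPreorder)
open import Relation.Nullary.Negation.Core using (¬_)

-- The real numbers, presented as a Cauchy-complete Archimedean ordered field.
-- Classically this characterises ℝ up to isomorphism. The axioms are chosen so
-- that they also hold constructively: _<_ is cotransitive (through the
-- apartness _#_) rather than decidable, x ≤ y means ¬ (y < x), and binary
-- maxima are part of the structure.
record RealNumbers (c ℓ₁ ℓ₂ : Level) : Set (L.suc (c L.⊔ ℓ₁ L.⊔ ℓ₂)) where
  infix  4 _<_ _≤_
  infixl 6 _⊔_

  field
    heytingField : HeytingField c ℓ₁ ℓ₂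

  open HeytingField heytingField public

  commutativeRing : CommutativeRing c ℓ₁
  commutativeRing = HeytingCommutativeRing.commutativeRing heytingCommutativeRing

  open CommutativeRing commutativeRing public
    using (ring; semiring; commutativeSemiring; +-rawMonoid)
  open RawSemiringDefinitions (Semiring.rawSemiring semiring) public using (_^_)

  fromℕ# : ℕ → Carrier
  fromℕ# n = RawMonoidDefinitions._×_ +-rawMonoid n 1#

  field
    _<_                  : Rel Carrier ℓ₂
    isStrictPartialOrder : IsStrictPartialOrder _≈_ _<_
    #⇔<⊎>                : ∀ x y → x # y ⇔ (x < y ⊎ y < x)
    +-monoʳ-<            : ∀ z {x y} → x < y → z + x < z + y
    *-pos                : ∀ {x y} → 0# < x → 0# < y → 0# < x * y

  _≤_ : Rel Carrier ℓ₂
  x ≤ y = ¬ (y < x)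

  field
    _⊔_      : Carrier → Carrier → Carrier
    supremum : Supremum _≤_ _⊔_

  ∣_∣ : Carrier → Carrier
  ∣ x ∣ = x ⊔ (- x)

  IsCauchy : (ℕ → Carrier) → Set (c L.⊔ ℓ₂)
  IsCauchy u = ∀ ε → 0# < ε →
    ∃[ n ] ∀ i j → n ℕ.≤ i → n ℕ.≤ j → ∣ u i - u j ∣ < ε

  _ConvergesTo_ : (ℕ → Carrier) → Carrier → Set (c L.⊔ ℓ₂)
  u ConvergesTo l = ∀ ε → 0# < ε → ∃[ n ] ∀ i → n ℕ.≤ i → ∣ u i - l ∣ < ε

  field
    archimedean : ∀ x → ∃[ n ] x < fromℕ# n
    complete    : ∀ u → IsCauchy u → ∃[ l ] u ConvergesTo l

module RealProperties {c ℓ₁ ℓ₂} (ℝ : RealNumbers c ℓ₁ ℓ₂) where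

  open RealNumbers ℝ
  open HeytingProperties heytingCommutativeRing using (1#0; x-0≈x; invertibleʳ⇒#; #-congʳ)
  open RingProperties ring using (-‿distribˡ-*; -‿distribʳ-*; -‿involutive)
  open SemiringSolver commutativeSemiring using (solve; _:=_; _:+_; _:*_)
  open IsStrictPartialOrder isStrictPartialOrder public
    using (<-resp-≈; <-respʳ-≈)
    renaming (irrefl to <-irrefl; trans to <-trans; asym to <-asym)

  <-cotrans : ∀ {x y} → x < y → ∀ z → x < z ⊎ z < y
  <-cotrans {x} {y} x<y z with #-cotrans (Equivalence.from (#⇔<⊎> x y) (inj₁ x<y)) z
  ... | inj₁ x#z with Equivalence.to (#⇔<⊎> x z) x#z
  ...   | inj₁ x<z = inj₁ x<z
  ...   | inj₂ z<x = inj₂ (<-trans z<x x<y)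
  <-cotrans {x} {y} x<y z | inj₂ z#y with Equivalence.to (#⇔<⊎> z y) z#y
  ...   | inj₁ z<y = inj₂ z<y
  ...   | inj₂ y<z = inj₁ (<-trans x<y y<z)

  <⇒≤ : ∀ {x y} → x < y → x ≤ y
  <⇒≤ x<y y<x = <-asym x<y y<x

  ≤-reflexive : ∀ {x y} → x ≈ y → x ≤ y
  ≤-reflexive x≈y y<x = <-irrefl (sym x≈y) y<x

  ≤-refl : ∀ {x} → x ≤ x
  ≤-refl = ≤-reflexive refl

  ≤-trans : ∀ {x y z} → x ≤ y → y ≤ z → x ≤ z
  ≤-trans {y = y} x≤y y≤z z<x with <-cotrans z<x y
  ... | inj₁ z<y = y≤z z<y
  ... | inj₂ y<x = x≤y y<x

  <-≤-trans : ∀ {x y z} → x < y → y ≤ z → x < z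
  <-≤-trans {z = z} x<y y≤z with <-cotrans x<y z
  ... | inj₁ x<z = x<z
  ... | inj₂ z<y = ⊥-elim (y≤z z<y)

  ≤-<-trans : ∀ {x y z} → x ≤ y → y < z → x < z
  ≤-<-trans {x = x} x≤y y<z with <-cotrans y<z x
  ... | inj₁ y<x = ⊥-elim (x≤y y<x)
  ... | inj₂ x<z = x<z

  ≤-antisym : ∀ {x y} → x ≤ y → y ≤ x → x ≈ y
  ≤-antisym {x} {y} x≤y y≤x = proj₁ (tight x y) helper
    where
    helper : ¬ (x # y)
    helper x#y with Equivalence.to (#⇔<⊎> x y) x#y
    ... | inj₁ x<y = y≤x x<y
    ... | inj₂ y<x = x≤y y<x

  ≤-isPreorder : IsPreorder _≈_ _≤_
  ≤-isPreorder = record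
    { isEquivalence = isEquivalence
    ; reflexive     = ≤-reflexive
    ; trans         = ≤-trans
    }

  module ≤-Reasoning = Triple
    ≤-isPreorder <-asym <-trans <-resp-≈ <⇒≤ <-≤-trans ≤-<-trans

  open ≤-Reasoning

  y≈x+[y-x] : ∀ x y → y ≈ x + (y - x)
  y≈x+[y-x] x y = begin-equality
    y              ≈⟨ +-identityʳ y ⟨
    y + 0#         ≈⟨ +-congˡ (-‿inverseʳ x) ⟨
    y + (x - x)    ≈⟨ solve 3 (λ x y m → y :+ (x :+ m) := x :+ (y :+ m)) refl x y (- x) ⟩
    x + (y - x)    ∎

  [x+y]-x≈y : ∀ x y → (x + y) - x ≈ y
  [x+y]-x≈y x y = begin-equality
    (x + y) - x    ≈⟨ solve 3 (λ x y m → (x :+ y) :+ m := y :+ (x :+ m)) refl x y (- x) ⟩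
    y + (x - x)    ≈⟨ +-congˡ (-‿inverseʳ x) ⟩
    y + 0#         ≈⟨ +-identityʳ y ⟩
    y              ∎

  +-cancelʳ-< : ∀ z {x y} → z + x < z + y → x < y
  +-cancelʳ-< z {x} {y} zx<zy = begin-strict
    x                ≈⟨ cancel x ⟨
    - z + (z + x)    <⟨ +-monoʳ-< (- z) zx<zy ⟩
    - z + (z + y)    ≈⟨ cancel y ⟩
    y                ∎
    where
    cancel : ∀ w → - z + (z + w) ≈ w
    cancel w = begin-equality
      - z + (z + w)  ≈⟨ +-assoc (- z) z w ⟨
      (- z + z) + w  ≈⟨ +-congʳ (-‿inverseˡ z) ⟩
      0# + w         ≈⟨ +-identityˡ w ⟩
      w              ∎

  +-monoʳ-≤ : ∀ z {x y} → x ≤ y → z + x ≤ z + y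
  +-monoʳ-≤ z x≤y zy<zx = x≤y (+-cancelʳ-< z zy<zx)

  +-monoˡ-≤ : ∀ z {x y} → x ≤ y → x + z ≤ y + z
  +-monoˡ-≤ z {x} {y} x≤y = begin
    x + z  ≈⟨ +-comm x z ⟩
    z + x  ≤⟨ +-monoʳ-≤ z x≤y ⟩
    z + y  ≈⟨ +-comm z y ⟩
    y + z  ∎

  +-mono-≤ : ∀ {x y u v} → x ≤ y → u ≤ v → x + u ≤ y + v
  +-mono-≤ {y = y} {u} x≤y u≤v = ≤-trans (+-monoˡ-≤ u x≤y) (+-monoʳ-≤ y u≤v)

  x≤x+y : ∀ {x y} → 0# ≤ y → x ≤ x + y
  x≤x+y {x} {y} 0≤y = begin
    x       ≈⟨ +-identityʳ x ⟨
    x + 0#  ≤⟨ +-monoʳ-≤ x 0≤y ⟩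
    x + y   ∎

  x<x+y : ∀ {x y} → 0# < y → x < x + y
  x<x+y {x} {y} 0<y = begin-strict
    x       ≈⟨ +-identityʳ x ⟨
    x + 0#  <⟨ +-monoʳ-< x 0<y ⟩
    x + y   ∎

  y≤x+y : ∀ {x y} → 0# ≤ x → y ≤ x + y
  y≤x+y {x} {y} 0≤x = ≤-trans (x≤x+y 0≤x) (≤-reflexive (+-comm y x))

  +-nonNeg : ∀ {x y} → 0# ≤ x → 0# ≤ y → 0# ≤ x + y
  +-nonNeg 0≤x 0≤y = ≤-trans 0≤x (x≤x+y 0≤y)

  +-pos : ∀ {x y} → 0# < x → 0# ≤ y → 0# < x + y
  +-pos 0<x 0≤y = <-≤-trans 0<x (x≤x+y 0≤y)

  x<y⇒0<y-x : ∀ {x y} → x < y → 0# < y - x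
  x<y⇒0<y-x {x} {y} x<y = +-cancelʳ-< x (begin-strict
    x + 0#       ≈⟨ +-identityʳ x ⟩
    x            <⟨ x<y ⟩
    y            ≈⟨ y≈x+[y-x] x y ⟩
    x + (y - x)  ∎)

  x≤y⇒0≤y-x : ∀ {x y} → x ≤ y → 0# ≤ y - x
  x≤y⇒0≤y-x {x} {y} x≤y y-x<0 = x≤y (begin-strict
    y            ≈⟨ y≈x+[y-x] x y ⟩
    x + (y - x)  <⟨ +-monoʳ-< x y-x<0 ⟩
    x + 0#       ≈⟨ +-identityʳ x ⟩
    x            ∎)

  x<0⇒0<-x : ∀ {x} → x < 0# → 0# < - x
  x<0⇒0<-x {x} x<0 = <-respʳ-≈ (+-identityˡ (- x)) (x<y⇒0<y-x x<0)

  -x*-x≈x*x : ∀ x → - x * - x ≈ x * x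
  -x*-x≈x*x x = begin-equality
    - x * - x      ≈⟨ -‿distribˡ-* x (- x) ⟨
    - (x * - x)    ≈⟨ -‿cong (sym (-‿distribʳ-* x x)) ⟩
    - (- (x * x))  ≈⟨ -‿involutive (x * x) ⟩
    x * x          ∎

  x#0⇒0<x*x : ∀ {x} → x # 0# → 0# < x * x
  x#0⇒0<x*x {x} x#0 with Equivalence.to (#⇔<⊎> x 0#) x#0
  ... | inj₁ x<0 = <-respʳ-≈ (-x*-x≈x*x x) (*-pos (x<0⇒0<-x x<0) (x<0⇒0<-x x<0))
  ... | inj₂ 0<x = *-pos 0<x 0<x

  0<1 : 0# < 1#
  0<1 = <-respʳ-≈ (*-identityˡ 1#) (x#0⇒0<x*x 1#0)

  0≤1 : 0# ≤ 1#
  0≤1 = <⇒≤ 0<1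

  0<x⇒x#0 : ∀ {x} → 0# < x → x # 0#
  0<x⇒x#0 {x} 0<x = Equivalence.from (#⇔<⊎> x 0#) (inj₂ 0<x)

  #0⇒inverse : ∀ {x} → x # 0# → ∃[ y ] x * y ≈ 1#
  #0⇒inverse {x} x#0 with #⇒invertible x#0
  ... | y , _ , [x-0]y≈1 = y , trans (*-congʳ (sym (x-0≈x x))) [x-0]y≈1

  x*y#0⇒x#0 : ∀ {x y} → x * y # 0# → x # 0#
  x*y#0⇒x#0 {x} {y} xy#0 with #0⇒inverse xy#0
  ... | z , xyz≈1 = invertibleʳ⇒# (y * z , (begin-equality
    (x - 0#) * (y * z)  ≈⟨ *-congʳ (x-0≈x x) ⟩
    x * (y * z)         ≈⟨ *-assoc x y z ⟨
    x * y * z           ≈⟨ xyz≈1 ⟩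
    1#                  ∎))

  x*y#0⇒0<x : ∀ {x y} → 0# ≤ x → x * y # 0# → 0# < x
  x*y#0⇒0<x {x} 0≤x xy#0 with Equivalence.to (#⇔<⊎> x 0#) (x*y#0⇒x#0 xy#0)
  ... | inj₁ x<0 = ⊥-elim (0≤x x<0)
  ... | inj₂ 0<x = 0<x

  *-nonNeg : ∀ {x y} → 0# ≤ x → 0# ≤ y → 0# ≤ x * y
  *-nonNeg {x} {y} 0≤x 0≤y xy<0 = <-asym xy<0 (*-pos
    (x*y#0⇒0<x 0≤x xy#0)
    (x*y#0⇒0<x 0≤y (#-congʳ (*-comm x y) xy#0)))
    where
    xy#0 : x * y # 0#
    xy#0 = Equivalence.from (#⇔<⊎> (x * y) 0#) (inj₁ xy<0)

  x*x-nonNeg : ∀ x → 0# ≤ x * x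
  x*x-nonNeg x xx<0 = <-asym xx<0
    (x#0⇒0<x*x (x*y#0⇒x#0 (Equivalence.from (#⇔<⊎> (x * x) 0#) (inj₁ xx<0))))

  *-monoʳ-≤ : ∀ {z x y} → 0# ≤ z → x ≤ y → z * x ≤ z * y
  *-monoʳ-≤ {z} {x} {y} 0≤z x≤y = begin
    z * x                ≤⟨ x≤x+y (*-nonNeg 0≤z (x≤y⇒0≤y-x x≤y)) ⟩
    z * x + z * (y - x)  ≈⟨ distribˡ z x (y - x) ⟨
    z * (x + (y - x))    ≈⟨ *-congˡ (y≈x+[y-x] x y) ⟨
    z * y                ∎

  *-monoˡ-≤ : ∀ {z x y} → 0# ≤ z → x ≤ y → x * z ≤ y * z
  *-monoˡ-≤ {z} {x} {y} 0≤z x≤y = begin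
    x * z  ≈⟨ *-comm x z ⟩
    z * x  ≤⟨ *-monoʳ-≤ 0≤z x≤y ⟩
    z * y  ≈⟨ *-comm z y ⟩
    y * z  ∎

  *-monoʳ-< : ∀ {z x y} → 0# < z → x < y → z * x < z * y
  *-monoʳ-< {z} {x} {y} 0<z x<y = begin-strict
    z * x                <⟨ x<x+y (*-pos 0<z (x<y⇒0<y-x x<y)) ⟩
    z * x + z * (y - x)  ≈⟨ distribˡ z x (y - x) ⟨
    z * (x + (y - x))    ≈⟨ *-congˡ (y≈x+[y-x] x y) ⟨
    z * y                ∎

  *-monoˡ-< : ∀ {z x y} → 0# < z → x < y → x * z < y * z
  *-monoˡ-< {z} {x} {y} 0<z x<y = begin-strict
    x * z  ≈⟨ *-comm x z ⟩
    z * x  <⟨ *-monoʳ-< 0<z x<y ⟩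
    z * y  ≈⟨ *-comm z y ⟩
    y * z  ∎

  abstract
    recip : ∀ x → 0# < x → Carrier
    recip x 0<x = proj₁ (#0⇒inverse (0<x⇒x#0 0<x))

    x*recip≈1 : ∀ x (0<x : 0# < x) → x * recip x 0<x ≈ 1#
    x*recip≈1 x 0<x = proj₂ (#0⇒inverse (0<x⇒x#0 0<x))

    recip-pos : ∀ x (0<x : 0# < x) → 0# < recip x 0<x
    recip-pos x 0<x = x*y#0⇒0<x 0≤r (#-congʳ (sym (trans (*-comm r x) xr≈1)) 1#0)
      where
      r : Carrier
      r = recip x 0<x
      xr≈1 : x * r ≈ 1#
      xr≈1 = x*recip≈1 x 0<x
      0≤r : 0# ≤ r
      0≤r r<0 = <-asym 0<1 (begin-strict
        1#       ≈⟨ xr≈1 ⟨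
        x * r    <⟨ *-monoʳ-< 0<x r<0 ⟩
        x * 0#   ≈⟨ zeroʳ x ⟩
        0#       ∎)

  *-cancelʳ-< : ∀ {z x y} → 0# < z → z * x < z * y → x < y
  *-cancelʳ-< {z} {x} {y} 0<z zx<zy = begin-strict
    x            ≈⟨ cancel x ⟨
    r * (z * x)  <⟨ *-monoʳ-< (recip-pos z 0<z) zx<zy ⟩
    r * (z * y)  ≈⟨ cancel y ⟩
    y            ∎
    where
    r = recip z 0<z
    cancel : ∀ w → r * (z * w) ≈ w
    cancel w = begin-equality
      r * (z * w)  ≈⟨ solve 3 (λ r z w → r :* (z :* w) := (z :* r) :* w) refl r z w ⟩
      (z * r) * w  ≈⟨ *-congʳ (x*recip≈1 z 0<z) ⟩
      1# * w       ≈⟨ *-identityˡ w ⟩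
      w            ∎

  fromℕ#-nonNeg : ∀ n → 0# ≤ fromℕ# n
  fromℕ#-nonNeg zero    = ≤-refl
  fromℕ#-nonNeg (suc n) = +-nonNeg 0≤1 (fromℕ#-nonNeg n)

  ^-nonNeg : ∀ n {x} → 0# ≤ x → 0# ≤ x ^ n
  ^-nonNeg zero    0≤x = 0≤1
  ^-nonNeg (suc n) 0≤x = *-nonNeg 0≤x (^-nonNeg n 0≤x)

  ^-pos : ∀ n {x} → 0# < x → 0# < x ^ n
  ^-pos zero    0<x = 0<1
  ^-pos (suc n) 0<x = *-pos 0<x (^-pos n 0<x)

  ^-mono-≤ : ∀ n {x y} → 0# ≤ x → x ≤ y → x ^ n ≤ y ^ n
  ^-mono-≤ zero    0≤x x≤y = ≤-refl
  ^-mono-≤ (suc n) 0≤x x≤y = ≤-trans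
    (*-monoʳ-≤ 0≤x (^-mono-≤ n 0≤x x≤y))
    (*-monoˡ-≤ (^-nonNeg n (≤-trans 0≤x x≤y)) x≤y)

  ^-mono-< : ∀ n {x y} → 0# ≤ x → x < y → x ^ suc n < y ^ suc n
  ^-mono-< n 0≤x x<y = ≤-<-trans
    (*-monoʳ-≤ 0≤x (^-mono-≤ n 0≤x (<⇒≤ x<y)))
    (*-monoˡ-< (^-pos n (≤-<-trans 0≤x x<y)) x<y)

  x≤∣x∣ : ∀ x → x ≤ ∣ x ∣
  x≤∣x∣ x = proj₁ (supremum x (- x))

  -x≤∣x∣ : ∀ x → - x ≤ ∣ x ∣
  -x≤∣x∣ x = proj₁ (proj₂ (supremum x (- x)))

  ∣x∣≤y : ∀ {x y} → x ≤ y → - x ≤ y → ∣ x ∣ ≤ y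
  ∣x∣≤y {x} {y} = proj₂ (proj₂ (supremum x (- x))) y

  -[x-y]≈y-x : ∀ x y → - (x - y) ≈ y - x
  -[x-y]≈y-x x y = RingProperties.⁻¹-anti-homo‿- ring x y

  x-y≤z : ∀ {x y z} → x ≤ y + z → x - y ≤ z
  x-y≤z {x} {y} {z} x≤y+z = begin
    x - y        ≤⟨ +-monoˡ-≤ (- y) x≤y+z ⟩
    (y + z) - y  ≈⟨ [x+y]-x≈y y z ⟩
    z            ∎

-- Roots exist by completeness: x lies between the powers of the end points of
-- intervals whose widths shrink by the factor 2/3; cotransitivity of _<_
-- decides which third of the interval may be dropped.
module Trisection {c ℓ₁ ℓ₂} (ℝ : RealNumbers c ℓ₁ ℓ₂)
                  (k : ℕ) (x : RealNumbers.Carrier ℝ)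
                  (0≤x : RealNumbers._≤_ ℝ (RealNumbers.0# ℝ) x) where

  open RealNumbers ℝ
  open RealProperties ℝ
  open ≤-Reasoning
  open SemiringExp semiring using (^-congˡ)
  open SemiringSolver commutativeSemiring using (solve; _:=_; _:+_; _:*_; con)

  0<3 : 0# < 1# + (1# + 1#)
  0<3 = +-pos 0<1 (+-nonNeg 0≤1 0≤1)

  ⅓ : Carrier
  ⅓ = recip (1# + (1# + 1#)) 0<3

  0<⅓ : 0# < ⅓
  0<⅓ = recip-pos _ 0<3

  3⅓≈1 : ⅓ + (⅓ + ⅓) ≈ 1#
  3⅓≈1 = trans
    (solve 1 (λ t → t :+ (t :+ t) := (con 1 :+ (con 1 :+ con 1)) :* t) refl ⅓)
    (x*recip≈1 _ 0<3)

  ⅔ : Carrier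
  ⅔ = ⅓ + ⅓

  0<⅔ : 0# < ⅔
  0<⅔ = +-pos 0<⅓ (<⇒≤ 0<⅓)

  w₀ : Carrier
  w₀ = 1# + x

  width : ℕ → Carrier
  width zero    = w₀
  width (suc n) = ⅔ * width n

  0<width : ∀ n → 0# < width n
  0<width zero    = +-pos 0<1 0≤x
  0<width (suc n) = *-pos 0<⅔ (0<width n)

  record Bracket (w : Carrier) : Set (c L.⊔ ℓ₂) where
    field
      left    : Carrier
      0≤left  : 0# ≤ left
      lower   : left ^ suc k ≤ x
      upper   : x ≤ (left + w) ^ suc k

  open Bracket

  bracket₀ : Bracket w₀
  bracket₀ = record
    { left   = 0#
    ; 0≤left = ≤-refl
    ; lower  = ≤-trans (≤-reflexive (zeroˡ (0# ^ k))) 0≤x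
    ; upper  = begin
        x                ≤⟨ y≤x+y 0≤1 ⟩
        w₀               ≈⟨ *-identityʳ w₀ ⟨
        w₀ * 1#          ≤⟨ *-monoʳ-≤ (<⇒≤ (0<width 0)) (1≤w₀^ k) ⟩
        w₀ ^ suc k       ≈⟨ ^-congˡ (suc k) (+-identityˡ w₀) ⟨
        (0# + w₀) ^ suc k ∎
    }
    where
    1≤w₀^ : ∀ n → 1# ≤ w₀ ^ n
    1≤w₀^ zero    = ≤-refl
    1≤w₀^ (suc n) = begin
      1#           ≤⟨ x≤x+y 0≤x ⟩
      w₀           ≈⟨ *-identityʳ w₀ ⟨
      w₀ * 1#      ≤⟨ *-monoʳ-≤ (<⇒≤ (0<width 0)) (1≤w₀^ n) ⟩
      w₀ ^ suc n   ∎

  step : ∀ {w} → 0# < w → (b : Bracket w) →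
         Σ (Bracket (⅔ * w)) λ b′ → left b ≤ left b′ × left b′ + ⅔ * w ≤ left b + w
  step {w} 0<w b = helper (<-cotrans (^-mono-< k 0≤m₁ m₁<m₂) x)
    where
    a  = left b
    m₁ = a + ⅓ * w
    m₂ = a + ⅔ * w

    0<⅓w : 0# < ⅓ * w
    0<⅓w = *-pos 0<⅓ 0<w

    0≤m₁ : 0# ≤ m₁
    0≤m₁ = +-nonNeg (0≤left b) (<⇒≤ 0<⅓w)

    m₁<m₂ : m₁ < m₂
    m₁<m₂ = begin-strict
      m₁                       <⟨ x<x+y 0<⅓w ⟩
      a + ⅓ * w + ⅓ * w        ≈⟨ solve 3 (λ a t w → a :+ t :* w :+ t :* w := a :+ (t :+ t) :* w) refl a ⅓ w ⟩
      m₂                       ∎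

    m₁+⅔w≈a+w : m₁ + ⅔ * w ≈ a + w
    m₁+⅔w≈a+w = begin-equality
      m₁ + ⅔ * w               ≈⟨ solve 3 (λ a t w → a :+ t :* w :+ (t :+ t) :* w := a :+ (t :+ (t :+ t)) :* w) refl a ⅓ w ⟩
      a + (⅓ + (⅓ + ⅓)) * w    ≈⟨ +-congˡ (trans (*-congʳ 3⅓≈1) (*-identityˡ w)) ⟩
      a + w                    ∎

    helper : m₁ ^ suc k < x ⊎ x < m₂ ^ suc k →
             Σ (Bracket (⅔ * w)) λ b′ → a ≤ left b′ × left b′ + ⅔ * w ≤ a + w
    helper (inj₁ m₁ᵏ<x) =
      record
        { left = m₁ ; 0≤left = 0≤m₁ ; lower = <⇒≤ m₁ᵏ<x
        ; upper = ≤-trans (upper b) (≤-reflexive (^-congˡ (suc k) (sym m₁+⅔w≈a+w)))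
        } , x≤x+y (<⇒≤ 0<⅓w) , ≤-reflexive m₁+⅔w≈a+w
    helper (inj₂ x<m₂ᵏ) =
      record
        { left = a ; 0≤left = 0≤left b ; lower = lower b ; upper = <⇒≤ x<m₂ᵏ }
      , ≤-refl
      , ≤-trans (+-monoˡ-≤ (⅔ * w) (x≤x+y (<⇒≤ 0<⅓w))) (≤-reflexive m₁+⅔w≈a+w)

  bracket : ∀ n → Bracket (width n)
  bracket zero    = bracket₀
  bracket (suc n) = proj₁ (step (0<width n) (bracket n))

  a b : ℕ → Carrier
  a n = left (bracket n)
  b n = a n + width n

  a≤b : ∀ n → a n ≤ b n
  a≤b n = x≤x+y (<⇒≤ (0<width n))

  a-mono : ∀ d n → a n ≤ a (d ℕ.+ n)
  a-mono zero    n = ≤-refl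
  a-mono (suc d) n = ≤-trans (a-mono d n)
    (proj₁ (proj₂ (step (0<width (d ℕ.+ n)) (bracket (d ℕ.+ n)))))

  b-anti : ∀ d n → b (d ℕ.+ n) ≤ b n
  b-anti zero    n = ≤-refl
  b-anti (suc d) n = ≤-trans
    (proj₂ (proj₂ (step (0<width (d ℕ.+ n)) (bracket (d ℕ.+ n))))) (b-anti d n)

  a≤a : ∀ {n i} → n ℕ.≤ i → a n ≤ a i
  a≤a {n} {i} n≤i = ≡.subst (λ j → a n ≤ a j) (ℕ.m∸n+n≡m n≤i) (a-mono (i ℕ.∸ n) n)

  a≤b′ : ∀ {n i} → n ℕ.≤ i → a i ≤ b n
  a≤b′ {n} {i} n≤i = ≤-trans (a≤b i)
    (≡.subst (λ j → b j ≤ b n) (ℕ.m∸n+n≡m n≤i) (b-anti (i ℕ.∸ n) n))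

  [n+2]width≤2w₀ : ∀ n → fromℕ# (2 ℕ.+ n) * width n ≤ fromℕ# 2 * w₀
  [n+2]width≤2w₀ zero    = ≤-refl
  [n+2]width≤2w₀ (suc n) = begin
    (1# + s) * (⅔ * width n)
      ≈⟨ solve 4 (λ o s t w → (o :+ s) :* ((t :+ t) :* w)
                           := (s :* t :+ s :* t :+ (o :+ o) :* t) :* w)
           refl 1# s ⅓ (width n) ⟩
    (s * ⅓ + s * ⅓ + (1# + 1#) * ⅓) * width n
      ≤⟨ *-monoˡ-≤ (<⇒≤ (0<width n)) (+-monoʳ-≤ _ (*-monoˡ-≤ (<⇒≤ 0<⅓) 2≤s)) ⟩
    (s * ⅓ + s * ⅓ + s * ⅓) * width n
      ≈⟨ solve 3 (λ s t w → (s :* t :+ s :* t :+ s :* t) :* w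
                         := (t :+ (t :+ t)) :* (s :* w))
           refl s ⅓ (width n) ⟩
    (⅓ + (⅓ + ⅓)) * (s * width n)
      ≈⟨ trans (*-congʳ 3⅓≈1) (*-identityˡ _) ⟩
    s * width n
      ≤⟨ [n+2]width≤2w₀ n ⟩
    fromℕ# 2 * w₀ ∎
    where
    s = fromℕ# (2 ℕ.+ n)
    2≤s : 1# + 1# ≤ s
    2≤s = +-monoʳ-≤ 1# (x≤x+y (fromℕ#-nonNeg n))

  width-small : ∀ ε → 0# < ε → ∃[ n ] width n < ε
  width-small ε 0<ε with archimedean (fromℕ# 2 * w₀ * recip ε 0<ε)
  ... | n , D/ε<n = n , *-cancelʳ-< 0<n+2 (begin-strict
    fromℕ# (2 ℕ.+ n) * width n             ≤⟨ [n+2]width≤2w₀ n ⟩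
    D                                      ≈⟨ *-identityˡ D ⟨
    1# * D                                 ≈⟨ *-congʳ (x*recip≈1 ε 0<ε) ⟨
    ε * r * D                              ≈⟨ solve 3 (λ e r d → e :* r :* d := e :* (d :* r)) refl ε r D ⟩
    ε * (D * r)                            <⟨ *-monoʳ-< 0<ε D/ε<n ⟩
    ε * fromℕ# n                           ≤⟨ *-monoʳ-≤ (<⇒≤ 0<ε) (≤-trans (y≤x+y 0≤1) (y≤x+y 0≤1)) ⟩
    ε * fromℕ# (2 ℕ.+ n)                   ≈⟨ *-comm ε _ ⟩
    fromℕ# (2 ℕ.+ n) * ε                   ∎)
    where
    r = recip ε 0<ε
    D = fromℕ# 2 * w₀
    0<n+2 : 0# < fromℕ# (2 ℕ.+ n)
    0<n+2 = +-pos 0<1 (fromℕ#-nonNeg (suc n))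

  a-cauchy : IsCauchy a
  a-cauchy ε 0<ε = proj₁ small , λ i j n≤i n≤j → ≤-<-trans
    (∣x∣≤y (diff i j n≤i n≤j)
      (≤-trans (≤-reflexive (-[x-y]≈y-x (a i) (a j))) (diff j i n≤j n≤i)))
    (proj₂ small)
    where
    small : ∃[ n ] width n < ε
    small = width-small ε 0<ε
    diff : ∀ i j → proj₁ small ℕ.≤ i → proj₁ small ℕ.≤ j →
           a i - a j ≤ width (proj₁ small)
    diff i j n≤i n≤j = x-y≤z (≤-trans (a≤b′ n≤i) (+-monoˡ-≤ _ (a≤a n≤j)))

  l : Carrier
  l = proj₁ (complete a a-cauchy)

  a→l : a ConvergesTo l
  a→l = proj₂ (complete a a-cauchy)

  a≤l : ∀ n → a n ≤ l
  a≤l n l<a = let m , close = a→l (a n - l) (x<y⇒0<y-x l<a) in <-irrefl refl (begin-strict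
    a n - l            ≤⟨ +-monoˡ-≤ (- l) (a≤a (ℕ.m≤n+m n m)) ⟩
    a (m ℕ.+ n) - l    ≤⟨ x≤∣x∣ _ ⟩
    ∣ a (m ℕ.+ n) - l ∣ <⟨ close (m ℕ.+ n) (ℕ.m≤m+n m n) ⟩
    a n - l            ∎)

  l≤b : ∀ n → l ≤ b n
  l≤b n b<l = <-irrefl refl (begin-strict
    l - b n                ≤⟨ x-y≤z (begin
        l                          ≈⟨ y≈x+[y-x] aᵢ l ⟩
        aᵢ + (l - aᵢ)              ≤⟨ +-monoˡ-≤ (l - aᵢ) (a≤b′ (ℕ.m≤n+m n m)) ⟩
        b n + (l - aᵢ)             ∎) ⟩
    l - aᵢ                 ≈⟨ -[x-y]≈y-x aᵢ l ⟨
    - (aᵢ - l)             ≤⟨ -x≤∣x∣ _ ⟩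
    ∣ aᵢ - l ∣             <⟨ proj₂ (a→l (l - b n) (x<y⇒0<y-x b<l)) (m ℕ.+ n) (ℕ.m≤m+n m n) ⟩
    l - b n                ∎)
    where
    m : ℕ
    m = proj₁ (a→l (l - b n) (x<y⇒0<y-x b<l))
    aᵢ : Carrier
    aᵢ = a (m ℕ.+ n)

  0≤l : 0# ≤ l
  0≤l = a≤l 0

  lipschitz : ℕ → Carrier
  lipschitz zero    = 0#
  lipschitz (suc n) = b 0 ^ n + b 0 * lipschitz n

  0≤b : ∀ n → 0# ≤ b n
  0≤b n = ≤-trans (0≤left (bracket n)) (a≤b n)

  0≤lipschitz : ∀ n → 0# ≤ lipschitz n
  0≤lipschitz zero    = ≤-refl
  0≤lipschitz (suc n) = +-nonNeg (^-nonNeg n (0≤b 0)) (*-nonNeg (0≤b 0) (0≤lipschitz n))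

  bⁱ≤aⁱ+Kw : ∀ i n → b n ^ i ≤ a n ^ i + lipschitz i * width n
  bⁱ≤aⁱ+Kw zero    n = x≤x+y (*-nonNeg ≤-refl (<⇒≤ (0<width n)))
  bⁱ≤aⁱ+Kw (suc i) n = begin
    b n * b n ^ i
      ≤⟨ *-monoʳ-≤ (0≤b n) (bⁱ≤aⁱ+Kw i n) ⟩
    (a n + width n) * (a n ^ i + lipschitz i * width n)
      ≈⟨ solve 4 (λ a w p K → (a :+ w) :* (p :+ K :* w)
                           := a :* p :+ (p :+ (a :+ w) :* K) :* w)
           refl (a n) (width n) (a n ^ i) (lipschitz i) ⟩
    a n * a n ^ i + (a n ^ i + b n * lipschitz i) * width n
      ≤⟨ +-monoʳ-≤ _ (*-monoˡ-≤ (<⇒≤ (0<width n)) (+-mono-≤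
           (^-mono-≤ i (0≤left (bracket n)) (a≤b′ {0} {n} ℕ.z≤n))
           (*-monoˡ-≤ (0≤lipschitz i)
             (≡.subst (λ j → b j ≤ b 0) (ℕ.+-identityʳ n) (b-anti n 0))))) ⟩
    a n * a n ^ i + lipschitz (suc i) * width n ∎

  K : Carrier
  K = 1# + lipschitz (suc k)

  0<K : 0# < K
  0<K = +-pos 0<1 (0≤lipschitz (suc k))

  bᵏ≤aᵏ+Kw : ∀ n → b n ^ suc k ≤ a n ^ suc k + K * width n
  bᵏ≤aᵏ+Kw n = ≤-trans (bⁱ≤aⁱ+Kw (suc k) n)
    (+-monoʳ-≤ _ (*-monoˡ-≤ (<⇒≤ (0<width n)) (y≤x+y 0≤1)))

  squeeze : ∀ {u v} → (∀ n → a n ^ suc k ≤ u) → (∀ n → v ≤ b n ^ suc k) → v ≤ u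
  squeeze {u} {v} aᵏ≤u v≤bᵏ u<v = <-irrefl refl (begin-strict
    v                            ≤⟨ v≤bᵏ n ⟩
    b n ^ suc k                  ≤⟨ bᵏ≤aᵏ+Kw n ⟩
    a n ^ suc k + K * width n    ≤⟨ +-monoˡ-≤ _ (aᵏ≤u n) ⟩
    u + K * width n              <⟨ +-monoʳ-< u (*-monoʳ-< 0<K (proj₂ small)) ⟩
    u + K * (r * (v - u))        ≈⟨ +-congˡ (*-assoc K r (v - u)) ⟨
    u + K * r * (v - u)          ≈⟨ +-congˡ (*-congʳ (x*recip≈1 K 0<K)) ⟩
    u + 1# * (v - u)             ≈⟨ +-congˡ (*-identityˡ (v - u)) ⟩
    u + (v - u)                  ≈⟨ y≈x+[y-x] u v ⟨
    v                            ∎)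
    where
    r : Carrier
    r = recip K 0<K
    small : ∃[ n ] width n < r * (v - u)
    small = width-small (r * (v - u)) (*-pos (recip-pos K 0<K) (x<y⇒0<y-x u<v))
    n : ℕ
    n = proj₁ small

  lᵏ≈x : l ^ suc k ≈ x
  lᵏ≈x = ≤-antisym
    (squeeze (λ n → lower (bracket n)) (λ n → ^-mono-≤ (suc k) 0≤l (l≤b n)))
    (squeeze (λ n → ^-mono-≤ (suc k) (0≤left (bracket n)) (a≤l n)) (λ n → upper (bracket n)))

module Plane {c ℓ₁ ℓ₂} (ℝ : RealNumbers c ℓ₁ ℓ₂) where

  open RealNumbers ℝ
  open RealProperties ℝ

  infix  4 _≈ₚ_ _<∞_ _∈ₖ_
  infixl 7 _*₊_ _/_ _/∞_
  infixl 6 _⊕_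

  record ℝ₊ : Set (c L.⊔ ℓ₂) where
    constructor _,₊_
    field
      value    : Carrier
      positive : 0# < value

  open ℝ₊ public

  _*₊_ : ℝ₊ → ℝ₊ → ℝ₊
  (x ,₊ 0<x) *₊ (y ,₊ 0<y) = (x * y) ,₊ *-pos 0<x 0<y

  _/_ : Carrier → ℝ₊ → Carrier
  x / (y ,₊ 0<y) = x * recip y 0<y

  2₊ : ℝ₊
  2₊ = (1# + 1#) ,₊ +-pos 0<1 0≤1

  abstract
    nthRoot : ∀ n .{{_ : NonZero n}} x → 0# ≤ x → ∃[ y ] (0# ≤ y × y ^ n ≈ x)
    nthRoot (suc k) x 0≤x = l , 0≤l , lᵏ≈x
      where open Trisection ℝ k x 0≤x

  √ : ∀ x → 0# ≤ x → Carrier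
  √ x 0≤x = proj₁ (nthRoot 2 x 0≤x)

  ∛ : ℝ₊ → ℝ₊
  ∛ (x ,₊ 0<x) = y ,₊ x*y#0⇒0<x (proj₁ y-root) (0<x⇒x#0 0<y³)
    where
    y : Carrier
    y = proj₁ (nthRoot 3 x (<⇒≤ 0<x))
    y-root : 0# ≤ y × y ^ 3 ≈ x
    y-root = proj₂ (nthRoot 3 x (<⇒≤ 0<x))
    0<y³ : 0# < y ^ 3
    0<y³ = <-respʳ-≈ (sym (proj₂ y-root)) 0<x

  Point : Set c
  Point = Carrier × Carrier

  _≈ₚ_ : Rel Point ℓ₁
  (x₁ , y₁) ≈ₚ (x₂ , y₂) = x₁ ≈ x₂ × y₁ ≈ y₂

  dist : Point → Point → Carrier
  dist (x₁ , y₁) (x₂ , y₂) =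
    √ ((x₁ - x₂) * (x₁ - x₂) + (y₁ - y₂) * (y₁ - y₂))
      (+-nonNeg (x*x-nonNeg (x₁ - x₂)) (x*x-nonNeg (y₁ - y₂)))

  triangleArea : Point → Point → Point → Carrier
  triangleArea (x₁ , y₁) (x₂ , y₂) (x₃ , y₃) =
    ∣ (x₂ - x₁) * (y₃ - y₁) - (x₃ - x₁) * (y₂ - y₁) ∣ / 2₊

  record Circle : Set (c L.⊔ ℓ₂) where
    field
      centre : Point
      radius : ℝ₊

  open Circle public

  _∈ₖ_ : Point → Circle → Set ℓ₁
  p ∈ₖ K = dist p (centre K) ≈ value (radius K)

  record UnitInterval : Set (c L.⊔ ℓ₂) where
    field
      coord   : Carrier
      0≤coord : 0# ≤ coord
      coord≤1 : coord ≤ 1#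

  open UnitInterval public

  0ᴵ 1ᴵ : UnitInterval
  0ᴵ = record { coord = 0# ; 0≤coord = ≤-refl ; coord≤1 = 0≤1 }
  1ᴵ = record { coord = 1# ; 0≤coord = 0≤1 ; coord≤1 = ≤-refl }

  IsContinuous : (UnitInterval → Point) → Set (c L.⊔ ℓ₂)
  IsContinuous γ = ∀ s ε → 0# < ε → ∃[ δ ] (0# < δ ×
    (∀ t → ∣ coord t - coord s ∣ < δ → dist (γ t) (γ s) < ε))

  record ClosedCurve : Set (c L.⊔ ℓ₁ L.⊔ ℓ₂) where
    field
      γ          : UnitInterval → Point
      continuous : IsContinuous γ
      closed     : γ 0ᴵ ≈ₚ γ 1ᴵ

  record Partition : Set (c L.⊔ ℓ₁ L.⊔ ℓ₂) where
    field
      size   : ℕ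
      node   : Fin (suc size) → UnitInterval
      first  : coord (node Fin.zero) ≈ 0#
      last   : coord (node (fromℕ size)) ≈ 1#
      mono   : ∀ i → coord (node (inject₁ i)) ≤ coord (node (Fin.suc i))

  inscribedLength : ClosedCurve → Partition → Carrier
  inscribedLength C π = RawMonoidDefinitions.sum +-rawMonoid
    (λ i → dist (γ (node (inject₁ i))) (γ (node (Fin.suc i))))
    where
    open ClosedCurve C
    open Partition π

  -- Values of lengths; a curve that is not rectifiable has length ∞.
  data ℝ∞ : Set c where
    fin : Carrier → ℝ∞
    ∞   : ℝ∞

  _<∞_ : Carrier → ℝ∞ → Set ℓ₂
  x <∞ fin y = x < y
  x <∞ ∞     = ⊤

  _/∞_ : ℝ∞ → ℝ₊ → ℝ∞
  fin x /∞ y = fin (x / y)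
  ∞     /∞ y = ∞

  -- The length is the supremum in ℝ ∪ {∞} of the lengths of inscribed polygons.
  IsLength : ClosedCurve → ℝ∞ → Set (c L.⊔ ℓ₁ L.⊔ ℓ₂)
  IsLength C (fin L) = Bound L × (∀ M → Bound M → L ≤ M)
    where
    Bound : Carrier → Set (c L.⊔ ℓ₁ L.⊔ ℓ₂)
    Bound M = ∀ π → inscribedLength C π ≤ M
  IsLength C ∞ = ∀ M → ∃[ π ] M < inscribedLength C π

  -- Indices are cyclic: P (j ⊕ k) is the k-th point after P j.
  _⊕_ : ∀ {N} .{{_ : NonZero N}} → Fin N → ℕ → Fin N
  _⊕_ {N} j k = (toℕ j ℕ.+ k) mod N

  Distinct : ∀ {N} → (Fin N → Point) → Set ℓ₁
  Distinct P = ∀ i j → i ≢ j → ¬ (P i ≈ₚ P j)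

  Increasing Decreasing : ∀ {N} → (Fin N → Carrier) → Set ℓ₂
  Increasing t = ∀ i j → i Fin.< j → t i < t j
  Decreasing t = ∀ i j → i Fin.< j → t j < t i

  -- The parameter interval with its end points identified is a circle, so
  -- parameters are taken in [0,1). Going once around it, in either direction
  -- and starting from a suitable index k, meets them in the listed order.
  record InCyclicOrder {N} .{{_ : NonZero N}} (C : ClosedCurve) (P : Fin N → Point)
         : Set (c L.⊔ ℓ₁ L.⊔ ℓ₂) where
    open ClosedCurve C
    field
      param   : Fin N → UnitInterval
      param<1 : ∀ j → coord (param j) < 1#
      onCurve : ∀ j → P j ≈ₚ γ (param j)
      ordered : ∃[ k ] (Increasing (λ j → coord (param (j ⊕ k)))
                      ⊎ Decreasing (λ j → coord (param (j ⊕ k))))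

{-# OPTIONS --safe #-}
module Submission where

open import Defs
open import Algebra.Bundles using (CommutativeRing)
import Algebra.Properties.AbelianGroup as AbelianGroupProperties
import Algebra.Properties.CommutativeMonoid.Sum as Sum
import Algebra.Properties.Ring as RingProperties
import Algebra.Properties.Semiring.Mult as Mult
open import Algebra.Solver.Ring.AlmostCommutativeRing using (fromCommutativeRing; _-Raw-AlmostCommutative⟶_)
import Algebra.Solver.Ring as RingSolver
open import Data.Empty using (⊥-elim)
open import Data.Fin.Base as Fin using (Fin; toℕ; inject₁; fromℕ; opposite)
import Data.Fin.Permutation as Perm
import Data.Fin.Properties as Fin
open import Data.Integer.Base as ℤ using (ℤ; +_; -[1+_]; _⊖_; _◃_)
import Data.Integer.Properties as ℤ
open import Data.Maybe.Base using (Maybe; just; nothing)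
open import Data.Nat.Base as ℕ using (ℕ; zero; suc; NonZero)
open import Data.Nat.DivMod using (_mod_; _%_; %-distribˡ-+; m%n%n≡m%n; m%n<n; [m+n]%n≡m%n)
import Data.Nat.Properties as ℕ
open import Data.Product.Base using (∃-syntax; _×_; _,_; proj₁; proj₂)
import Data.Sign.Base as Sign
open import Data.Sum.Base using (_⊎_; inj₁; inj₂)
open import Function.Base using (_∘_)
open import Relation.Binary.PropositionalEquality as ≡ using (_≡_)
import Relation.Binary.Reasoning.Setoid as SetoidReasoning
open import Relation.Nullary.Decidable.Core using (yes; no)
open import Relation.Nullary.Negation.Core using (contradiction)

-- For consecutive points with sides a, b and chord c, the circumradius formula
-- abc = 4 R Area gives abc ≥ 2 A₀R₀. As c < a + b (strictly, the area being
-- positive) and 4ab ≤ (a + b)², this forces (a + b)³ > 8 A₀R₀. Summing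
-- a + b > 2 (A₀R₀)^(1/3) once around the polygon counts each side twice, and
-- the perimeter is at most the length of the curve.

-- Ring solving with integer coefficients.

-- Equality in R is not decidable, so the ring solver can only cancel terms if
-- its coefficients are taken from ℤ.
module IntegerCoefficients {c ℓ} (R : CommutativeRing c ℓ) where

  open CommutativeRing R
  open RingProperties ring using (-0#≈0#; -‿distribˡ-*; -‿distribʳ-*; -‿involutive)
  open AbelianGroupProperties +-abelianGroup using (⁻¹-∙-comm)
  open Mult semiring using (×-homo-+; ×1-homo-*) renaming (_×_ to _·_)
  open SetoidReasoning setoid

  ⟦_⟧ : ℤ → Carrier
  ⟦ + n ⟧      = n · 1#
  ⟦ -[1+ n ] ⟧ = - (suc n · 1#)

  ⟦-⟧-homo : ∀ i → ⟦ ℤ.- i ⟧ ≈ - ⟦ i ⟧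
  ⟦-⟧-homo (+ zero)  = sym -0#≈0#
  ⟦-⟧-homo (+ suc n) = refl
  ⟦-⟧-homo -[1+ n ]  = sym (-‿involutive _)

  [z+x]-[z+y]≈x-y : ∀ x y z → (z + x) - (z + y) ≈ x - y
  [z+x]-[z+y]≈x-y x y z = begin
    (z + x) - (z + y)      ≈⟨ +-cong (+-comm x z) (⁻¹-∙-comm z y) ⟨
    (x + z) + (- z - y)    ≈⟨ +-assoc x z _ ⟩
    x + (z + (- z - y))    ≈⟨ +-congˡ (+-assoc z (- z) (- y)) ⟨
    x + ((z - z) - y)      ≈⟨ +-congˡ (+-congʳ (-‿inverseʳ z)) ⟩
    x + (0# - y)           ≈⟨ +-congˡ (+-identityˡ (- y)) ⟩
    x - y                  ∎

  ⟦⊖⟧-homo : ∀ m n → ⟦ m ⊖ n ⟧ ≈ m · 1# - n · 1#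
  ⟦⊖⟧-homo m       zero    = sym (trans (+-congˡ -0#≈0#) (+-identityʳ _))
  ⟦⊖⟧-homo zero    (suc n) = sym (+-identityˡ _)
  ⟦⊖⟧-homo (suc m) (suc n) = begin
    ⟦ suc m ⊖ suc n ⟧                    ≡⟨ ≡.cong ⟦_⟧ (ℤ.[1+m]⊖[1+n]≡m⊖n m n) ⟩
    ⟦ m ⊖ n ⟧                            ≈⟨ ⟦⊖⟧-homo m n ⟩
    m · 1# - n · 1#                      ≈⟨ [z+x]-[z+y]≈x-y _ _ 1# ⟨
    suc m · 1# - suc n · 1#              ∎

  ⟦+⟧-homo : ∀ i j → ⟦ i ℤ.+ j ⟧ ≈ ⟦ i ⟧ + ⟦ j ⟧
  ⟦+⟧-homo (+ m)    (+ n)    = ×-homo-+ 1# m n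
  ⟦+⟧-homo (+ m)    -[1+ n ] = ⟦⊖⟧-homo m (suc n)
  ⟦+⟧-homo -[1+ m ] (+ n)    = trans (⟦⊖⟧-homo n (suc m)) (+-comm _ _)
  ⟦+⟧-homo -[1+ m ] -[1+ n ] = begin
    - (suc (suc (m ℕ.+ n)) · 1#)       ≡⟨ ≡.cong (λ k → - (suc k · 1#)) (ℕ.+-suc m n) ⟨
    - ((suc m ℕ.+ suc n) · 1#)         ≈⟨ -‿cong (×-homo-+ 1# (suc m) (suc n)) ⟩
    - (suc m · 1# + suc n · 1#)        ≈⟨ ⁻¹-∙-comm _ _ ⟨
    - (suc m · 1#) - (suc n · 1#)      ∎

  ⟦+◃⟧ : ∀ n → ⟦ Sign.+ ◃ n ⟧ ≈ n · 1#
  ⟦+◃⟧ zero    = refl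
  ⟦+◃⟧ (suc n) = refl

  ⟦-◃⟧ : ∀ n → ⟦ Sign.- ◃ n ⟧ ≈ - (n · 1#)
  ⟦-◃⟧ zero    = sym -0#≈0#
  ⟦-◃⟧ (suc n) = refl

  ⟦*⟧-homo : ∀ i j → ⟦ i ℤ.* j ⟧ ≈ ⟦ i ⟧ * ⟦ j ⟧
  ⟦*⟧-homo (+ m)    (+ n)    = trans (⟦+◃⟧ (m ℕ.* n)) (×1-homo-* m n)
  ⟦*⟧-homo (+ m)    -[1+ n ] = begin
    ⟦ Sign.- ◃ m ℕ.* suc n ⟧         ≈⟨ ⟦-◃⟧ (m ℕ.* suc n) ⟩
    - ((m ℕ.* suc n) · 1#)           ≈⟨ -‿cong (×1-homo-* m (suc n)) ⟩
    - (m · 1# * (suc n · 1#))        ≈⟨ -‿distribʳ-* _ _ ⟩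
    m · 1# * - (suc n · 1#)          ∎
  ⟦*⟧-homo -[1+ m ] (+ n)    = begin
    ⟦ Sign.- ◃ suc m ℕ.* n ⟧         ≈⟨ ⟦-◃⟧ (suc m ℕ.* n) ⟩
    - ((suc m ℕ.* n) · 1#)           ≈⟨ -‿cong (×1-homo-* (suc m) n) ⟩
    - (suc m · 1# * (n · 1#))        ≈⟨ -‿distribˡ-* _ _ ⟩
    - (suc m · 1#) * (n · 1#)        ∎
  ⟦*⟧-homo -[1+ m ] -[1+ n ] = begin
    (suc m ℕ.* suc n) · 1#           ≈⟨ ×1-homo-* (suc m) (suc n) ⟩
    x * y                            ≈⟨ -‿involutive (x * y) ⟨
    - - (x * y)                      ≈⟨ -‿cong (-‿distribʳ-* x y) ⟩
    - (x * - y)                      ≈⟨ -‿distribˡ-* x (- y) ⟩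
    - x * - y                        ∎
    where
    x y : Carrier
    x = suc m · 1#
    y = suc n · 1#

  morphism : ℤ.+-*-rawRing -Raw-AlmostCommutative⟶ fromCommutativeRing R
  morphism = record
    { ⟦_⟧    = ⟦_⟧
    ; +-homo = ⟦+⟧-homo
    ; *-homo = ⟦*⟧-homo
    ; -‿homo = ⟦-⟧-homo
    ; 0-homo = refl
    ; 1-homo = +-identityʳ 1#
    }

  -- The integers themselves are compared; `nothing` makes no claim, since distinct integers may
  -- have equal images in `R`.
  ⟦⟧-≟ : ∀ i j → Maybe (⟦ i ⟧ ≈ ⟦ j ⟧)
  ⟦⟧-≟ i j with i ℤ.≟ j
  ... | yes i≡j = just (reflexive (≡.cong ⟦_⟧ i≡j))
  ... | no  _   = nothing

  open RingSolver ℤ.+-*-rawRing (fromCommutativeRing R) morphism ⟦⟧-≟ public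
    using (solve; _:=_; _:+_; _:*_; _:-_; :-_)

-- Cyclic indices.

toℕ-mod : ∀ m N .{{_ : NonZero N}} → toℕ (m mod N) ≡ m % N
toℕ-mod m N = Fin.toℕ-fromℕ< (m%n<n m N)

mod-cong : ∀ m n N .{{_ : NonZero N}} → m % N ≡ n % N → m mod N ≡ n mod N
mod-cong m n N m≡n = Fin.toℕ-injective
  (≡.trans (toℕ-mod m N) (≡.trans m≡n (≡.sym (toℕ-mod n N))))

-- The left side is `(m mod N) ⊕ l`. On the right `l` comes first, so that for a literal `l` the sum
-- reduces to successors of `m`.
toℕ-mod-+-mod : ∀ m l N .{{_ : NonZero N}} → (toℕ (m mod N) ℕ.+ l) mod N ≡ (l ℕ.+ m) mod N
toℕ-mod-+-mod m l N = mod-cong _ (l ℕ.+ m) N (begin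
  (toℕ (m mod N) ℕ.+ l) % N          ≡⟨ ≡.cong (λ i → (i ℕ.+ l) % N) (toℕ-mod m N) ⟩
  (m % N ℕ.+ l) % N                  ≡⟨ %-distribˡ-+ (m % N) l N ⟩
  ((m % N) % N ℕ.+ l % N) % N        ≡⟨ ≡.cong (λ i → (i ℕ.+ l % N) % N) (m%n%n≡m%n m N) ⟩
  (m % N ℕ.+ l % N) % N              ≡⟨ %-distribˡ-+ m l N ⟨
  (m ℕ.+ l) % N                      ≡⟨ ≡.cong (_% N) (ℕ.+-comm m l) ⟩
  (l ℕ.+ m) % N                      ∎)
  where open ≡.≡-Reasoning

-- Reversing and extending finite sequences.

-- Together with the defining equation of `opposite` at `suc i`, this shows that reversal takes edge
-- `i` to edge `opposite i` with its ends exchanged.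
opposite-inject₁ : ∀ {n} (i : Fin n) → opposite (inject₁ i) ≡ Fin.suc (opposite i)
opposite-inject₁ Fin.zero    = ≡.refl
opposite-inject₁ (Fin.suc i) = ≡.cong inject₁ (opposite-inject₁ i)

opposite-fromℕ : ∀ n → opposite (fromℕ n) ≡ Fin.zero
opposite-fromℕ zero    = ≡.refl
opposite-fromℕ (suc n) = ≡.cong inject₁ (opposite-fromℕ n)

inject₁<suc : ∀ {n} (i : Fin n) → inject₁ i Fin.< Fin.suc i
inject₁<suc i = ℕ.s≤s (ℕ.≤-reflexive (Fin.toℕ-inject₁ i))

infixl 5 _∷ʳ_
_∷ʳ_ : ∀ {a} {A : Set a} {n} → (Fin n → A) → A → Fin (suc n) → A
_∷ʳ_ {n = zero}  x y _           = y
_∷ʳ_ {n = suc n} x y Fin.zero    = x Fin.zero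
_∷ʳ_ {n = suc n} x y (Fin.suc i) = (x ∘ Fin.suc ∷ʳ y) i

∷ʳ-last : ∀ {a} {A : Set a} {n} (x : Fin n → A) y → (x ∷ʳ y) (fromℕ n) ≡ y
∷ʳ-last {n = zero}  x y = ≡.refl
∷ʳ-last {n = suc n} x y = ∷ʳ-last (x ∘ Fin.suc) y

Adjacent : ∀ {a r n} {A : Set a} → (A → A → Set r) → (Fin (suc n) → A) → Set r
Adjacent _∼_ x = ∀ i → x (inject₁ i) ∼ x (Fin.suc i)

∷ʳ-adjacent : ∀ {a r n} {A : Set a} {_∼_ : A → A → Set r} (x : Fin (suc n) → A) {y} →
  Adjacent _∼_ x → x (fromℕ n) ∼ y → Adjacent _∼_ (x ∷ʳ y)
∷ʳ-adjacent {n = zero}  x adj x∼y Fin.zero    = x∼y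
∷ʳ-adjacent {n = suc n} x adj x∼y Fin.zero    = adj Fin.zero
∷ʳ-adjacent {n = suc n} {_∼_ = _∼_} x adj x∼y (Fin.suc i) =
  ∷ʳ-adjacent {_∼_ = _∼_} (x ∘ Fin.suc) (adj ∘ Fin.suc) x∼y i

module PlaneGeometry {c ℓ₁ ℓ₂} (ℝ : RealNumbers c ℓ₁ ℓ₂) where

  open RealNumbers ℝ
  open RealProperties ℝ
  open Plane ℝ
  open ≤-Reasoning
  open IntegerCoefficients commutativeRing using (solve; _:=_; _:+_; _:*_; _:-_; :-_)

  -- Comparing numbers through their squares and powers.

  +-mono-<-≤ : ∀ {x y u v} → x < y → u ≤ v → x + u < y + v
  +-mono-<-≤ {x} {y} {u} {v} x<y u≤v = begin-strict
    x + u  ≈⟨ +-comm x u ⟩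
    u + x  <⟨ +-monoʳ-< u x<y ⟩
    u + y  ≈⟨ +-comm u y ⟩
    y + u  ≤⟨ +-monoʳ-≤ y u≤v ⟩
    y + v  ∎

  +-mono-< : ∀ {x y u v} → x < y → u < v → x + u < y + v
  +-mono-< x<y u<v = +-mono-<-≤ x<y (<⇒≤ u<v)

  -- By contraposition, as `_≤_` is the negation of `_<_`: if `y < x`, then `x` is positive and has
  -- the larger square.
  x*x≤y*y⇒x≤y : ∀ {x y} → 0# ≤ y → x * x ≤ y * y → x ≤ y
  x*x≤y*y⇒x≤y {x} {y} 0≤y xx≤yy y<x = xx≤yy (begin-strict
    y * y  ≤⟨ *-monoʳ-≤ 0≤y (<⇒≤ y<x) ⟩
    y * x  <⟨ *-monoˡ-< (≤-<-trans 0≤y y<x) y<x ⟩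
    x * x  ∎)

  x*x≈y*y⇒x≈y : ∀ {x y} → 0# ≤ x → 0# ≤ y → x * x ≈ y * y → x ≈ y
  x*x≈y*y⇒x≈y 0≤x 0≤y xx≈yy = ≤-antisym
    (x*x≤y*y⇒x≤y 0≤y (≤-reflexive xx≈yy))
    (x*x≤y*y⇒x≤y 0≤x (≤-reflexive (sym xx≈yy)))

  0<y-x⇒x<y : ∀ {x y} → 0# < y - x → x < y
  0<y-x⇒x<y {x} {y} 0<y-x = <-respʳ-≈ (sym (y≈x+[y-x] x y)) (x<x+y 0<y-x)

  -- The product `(y - x) * (y + x)` is positive, so its factor `y - x` is apart from zero; the weak
  -- version excludes a negative sign.
  x*x<y*y⇒x<y : ∀ {x y} → 0# ≤ y → x * x < y * y → x < y
  x*x<y*y⇒x<y {x} {y} 0≤y xx<yy = 0<y-x⇒x<y (x*y#0⇒0<x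
    (x≤y⇒0≤y-x (x*x≤y*y⇒x≤y 0≤y (<⇒≤ xx<yy)))
    (0<x⇒x#0 (<-respʳ-≈
      (solve 2 (λ x y → y :* y :- x :* x := (y :- x) :* (y :+ x)) refl x y)
      (x<y⇒0<y-x xx<yy))))

  -- The hypothesis itself makes `z` positive: `z * (y - x)` is apart from zero, hence so is `z`.
  *-cancelʳ-<-nonNeg : ∀ {x y z} → 0# ≤ z → z * x < z * y → x < y
  *-cancelʳ-<-nonNeg {x} {y} {z} 0≤z zx<zy = *-cancelʳ-< (x*y#0⇒0<x 0≤z (0<x⇒x#0
    (<-respʳ-≈ (solve 3 (λ x y z → z :* y :- z :* x := z :* (y :- x)) refl x y z)
      (x<y⇒0<y-x zx<zy)))) zx<zy

  -- Cotransitivity at the intermediate value `y * x ^ n` replaces a case distinction on `x` and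
  -- `y`: either `x ^ n` can be cancelled, or `y` can, which leaves a smaller exponent.
  ^-cancel-< : ∀ n {x y} → 0# ≤ x → 0# ≤ y → x ^ n < y ^ n → x < y
  ^-cancel-< zero    0≤x 0≤y 1<1 = ⊥-elim (<-irrefl refl 1<1)
  ^-cancel-< (suc n) {x} {y} 0≤x 0≤y xⁿ<yⁿ with <-cotrans xⁿ<yⁿ (y * x ^ n)
  ... | inj₁ xxⁿ<yxⁿ = *-cancelʳ-<-nonNeg (^-nonNeg n 0≤x) (begin-strict
    x ^ n * x  ≈⟨ *-comm _ x ⟩
    x * x ^ n  <⟨ xxⁿ<yxⁿ ⟩
    y * x ^ n  ≈⟨ *-comm y _ ⟩
    x ^ n * y  ∎)
  ... | inj₂ yxⁿ<yyⁿ = ^-cancel-< n 0≤x 0≤y (*-cancelʳ-<-nonNeg 0≤y yxⁿ<yyⁿ)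

  -- The sign of `x` cannot be decided. If `x * x < y * y`, then both `x` and `- x` lie below `y`. A
  -- positive `x` would give `∣ x ∣ ≤ x < y`, so `x ≤ 0#`, and then `∣ x ∣ ≤ - x < y`.
  y≤∣x∣⇒y*y≤x*x : ∀ {x y} → 0# ≤ y → y ≤ ∣ x ∣ → y * y ≤ x * x
  y≤∣x∣⇒y*y≤x*x {x} {y} 0≤y y≤∣x∣ xx<yy = y≤∣x∣ (≤-<-trans (∣x∣≤y x≤-x ≤-refl) -x<y)
    where
    -x<y : - x < y
    -x<y = x*x<y*y⇒x<y 0≤y (≤-<-trans (≤-reflexive (-x*-x≈x*x x)) xx<yy)

    x≤0 : x ≤ 0#
    x≤0 0<x = y≤∣x∣ (≤-<-trans (∣x∣≤y ≤-refl -x≤x) (x*x<y*y⇒x<y 0≤y xx<yy))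
      where
      -x≤x : - x ≤ x
      -x≤x = begin
        - x            ≤⟨ x≤x+y (+-nonNeg (<⇒≤ 0<x) (<⇒≤ 0<x)) ⟩
        - x + (x + x)  ≈⟨ solve 1 (λ x → :- x :+ (x :+ x) := x) refl x ⟩
        x              ∎

    x≤-x : x ≤ - x
    x≤-x = begin
      x       ≤⟨ x≤0 ⟩
      0#      ≤⟨ x≤y⇒0≤y-x x≤0 ⟩
      0# - x  ≈⟨ +-identityˡ (- x) ⟩
      - x     ∎

  -- Distances, dot products and cross products.

  normSq : Point → Carrier
  normSq (x₁ , x₂) = x₁ * x₁ + x₂ * x₂

  infixl 6 _-ₚ_
  _-ₚ_ : Point → Point → Point
  (x₁ , x₂) -ₚ (y₁ , y₂) = (x₁ - y₁) , (x₂ - y₂)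

  dot cross : Point → Point → Carrier
  dot   (x₁ , x₂) (y₁ , y₂) = x₁ * y₁ + x₂ * y₂
  cross (x₁ , x₂) (y₁ , y₂) = x₁ * y₂ - y₁ * x₂

  dist-nonNeg : ∀ p q → 0# ≤ dist p q
  dist-nonNeg p q = proj₁ (proj₂ (nthRoot 2 (normSq (p -ₚ q)) _))

  dist*dist : ∀ p q → dist p q * dist p q ≈ normSq (p -ₚ q)
  dist*dist p q = trans (*-congˡ (sym (*-identityʳ _)))
    (proj₂ (proj₂ (nthRoot 2 (normSq (p -ₚ q)) _)))

  dist-cong : ∀ {p p′ q q′} → p ≈ₚ p′ → q ≈ₚ q′ → dist p q ≈ dist p′ q′
  dist-cong {p} {p′} {q} {q′} (p₁ , p₂) (q₁ , q₂) =
    x*x≈y*y⇒x≈y (dist-nonNeg p q) (dist-nonNeg p′ q′) (begin-equality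
      dist p q * dist p q      ≈⟨ dist*dist p q ⟩
      normSq (p -ₚ q)          ≈⟨ +-cong (*-cong e₁ e₁) (*-cong e₂ e₂) ⟩
      normSq (p′ -ₚ q′)        ≈⟨ dist*dist p′ q′ ⟨
      dist p′ q′ * dist p′ q′  ∎)
    where
    e₁ = +-cong p₁ (-‿cong q₁)
    e₂ = +-cong p₂ (-‿cong q₂)

  dist-sym : ∀ p q → dist p q ≈ dist q p
  dist-sym p@(p₁ , p₂) q@(q₁ , q₂) =
    x*x≈y*y⇒x≈y (dist-nonNeg p q) (dist-nonNeg q p) (begin-equality
      dist p q * dist p q  ≈⟨ dist*dist p q ⟩
      normSq (p -ₚ q)      ≈⟨ +-cong (swap p₁ q₁) (swap p₂ q₂) ⟩
      normSq (q -ₚ p)      ≈⟨ dist*dist q p ⟨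
      dist q p * dist q p  ∎)
    where
    swap : ∀ x y → (x - y) * (x - y) ≈ (y - x) * (y - x)
    swap = solve 2 (λ x y → (x :- y) :* (x :- y) := (y :- x) :* (y :- x)) refl

  -- The Cauchy-Schwarz inequality with its exact defect: the squared cross product is what later
  -- makes the triangle inequality strict.
  lagrange : ∀ x y → normSq x * normSq y ≈ dot x y * dot x y + cross x y * cross x y
  lagrange (x₁ , x₂) (y₁ , y₂) = solve 4 (λ x₁ x₂ y₁ y₂ →
    (x₁ :* x₁ :+ x₂ :* x₂) :* (y₁ :* y₁ :+ y₂ :* y₂)
      := (x₁ :* y₁ :+ x₂ :* y₂) :* (x₁ :* y₁ :+ x₂ :* y₂)
         :+ (x₁ :* y₂ :- y₁ :* x₂) :* (x₁ :* y₂ :- y₁ :* x₂))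
    refl x₁ x₂ y₁ y₂

  -- Reduces to the expression inside the absolute value of `triangleArea`, so the area hypothesis
  -- applies to it without rewriting.
  twiceSignedArea : Point → Point → Point → Carrier
  twiceSignedArea p q r = cross (q -ₚ p) (r -ₚ p)

  cross-edges : ∀ p q r → cross (p -ₚ q) (q -ₚ r) ≈ twiceSignedArea p q r
  cross-edges (p₁ , p₂) (q₁ , q₂) (r₁ , r₂) = solve 6 (λ p₁ p₂ q₁ q₂ r₁ r₂ →
    (p₁ :- q₁) :* (q₂ :- r₂) :- (q₁ :- r₁) :* (p₂ :- q₂)
      := (q₁ :- p₁) :* (r₂ :- p₂) :- (r₁ :- p₁) :* (q₂ :- p₂))
    refl p₁ p₂ q₁ q₂ r₁ r₂

  -- The dot product has a plus sign because the edge vectors `p -ₚ q` and `q -ₚ r` are laid head to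
  -- tail and add up to `p -ₚ r`.
  lawOfCosines : ∀ p q r →
    normSq (p -ₚ r) ≈ normSq (p -ₚ q) + normSq (q -ₚ r) + (dot (p -ₚ q) (q -ₚ r) + dot (p -ₚ q) (q -ₚ r))
  lawOfCosines (p₁ , p₂) (q₁ , q₂) (r₁ , r₂) = solve 6 (λ p₁ p₂ q₁ q₂ r₁ r₂ →
    let dt = (p₁ :- q₁) :* (q₁ :- r₁) :+ (p₂ :- q₂) :* (q₂ :- r₂)
        sq = λ a b → a :* a :+ b :* b
    in sq (p₁ :- r₁) (p₂ :- r₂)
         := sq (p₁ :- q₁) (p₂ :- q₂) :+ sq (q₁ :- r₁) (q₂ :- r₂) :+ (dt :+ dt))
    refl p₁ p₂ q₁ q₂ r₁ r₂

  -- The triangle inequality and its strict form.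

  module Triangle (p q r : Point) where

    a b c′ D d : Carrier
    a  = dist p q
    b  = dist q r
    c′ = dist p r
    D  = twiceSignedArea p q r
    d  = dot (p -ₚ q) (q -ₚ r)

    0≤a : 0# ≤ a
    0≤a = dist-nonNeg p q

    0≤b : 0# ≤ b
    0≤b = dist-nonNeg q r

    0≤c : 0# ≤ c′
    0≤c = dist-nonNeg p r

    0≤ab : 0# ≤ a * b
    0≤ab = *-nonNeg 0≤a 0≤b

    0≤a+b : 0# ≤ a + b
    0≤a+b = +-nonNeg 0≤a 0≤b

    abab≈dd+DD : (a * b) * (a * b) ≈ d * d + D * D
    abab≈dd+DD = begin-equality
      (a * b) * (a * b)
        ≈⟨ solve 2 (λ a b → (a :* b) :* (a :* b) := (a :* a) :* (b :* b)) refl a b ⟩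
      (a * a) * (b * b)
        ≈⟨ *-cong (dist*dist p q) (dist*dist q r) ⟩
      normSq (p -ₚ q) * normSq (q -ₚ r)
        ≈⟨ lagrange (p -ₚ q) (q -ₚ r) ⟩
      d * d + cross (p -ₚ q) (q -ₚ r) * cross (p -ₚ q) (q -ₚ r)
        ≈⟨ +-congˡ (*-cong (cross-edges p q r) (cross-edges p q r)) ⟩
      d * d + D * D ∎

    cc≈aa+bb+2d : c′ * c′ ≈ a * a + b * b + (d + d)
    cc≈aa+bb+2d = trans (dist*dist p r) (trans (lawOfCosines p q r)
      (+-congʳ (sym (+-cong (dist*dist p q) (dist*dist q r)))))

    [a+b][a+b] : a * a + b * b + (a * b + a * b) ≈ (a + b) * (a + b)
    [a+b][a+b] = solve 2
      (λ a b → a :* a :+ b :* b :+ (a :* b :+ a :* b) := (a :+ b) :* (a :+ b)) refl a b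

    c≤a+b : c′ ≤ a + b
    c≤a+b = x*x≤y*y⇒x≤y 0≤a+b (begin
      c′ * c′                          ≈⟨ cc≈aa+bb+2d ⟩
      a * a + b * b + (d + d)          ≤⟨ +-monoʳ-≤ _ (+-mono-≤ d≤ab d≤ab) ⟩
      a * a + b * b + (a * b + a * b)  ≈⟨ [a+b][a+b] ⟩
      (a + b) * (a + b)                ∎)
      where
      d≤ab : d ≤ a * b
      d≤ab = x*x≤y*y⇒x≤y 0≤ab
        (≤-trans (x≤x+y (x*x-nonNeg D)) (≤-reflexive (sym abab≈dd+DD)))

    -- A positive `D * D` separates `d * d` strictly from `(a * b) * (a * b)`, so the dot product in
    -- the law of cosines is less than `a * b`.
    c<a+b : 0# < D * D → c′ < a + b
    c<a+b 0<DD = x*x<y*y⇒x<y 0≤a+b (begin-strict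
      c′ * c′                          ≈⟨ cc≈aa+bb+2d ⟩
      a * a + b * b + (d + d)          <⟨ +-monoʳ-< _ (+-mono-< d<ab d<ab) ⟩
      a * a + b * b + (a * b + a * b)  ≈⟨ [a+b][a+b] ⟩
      (a + b) * (a + b)                ∎)
      where
      d<ab : d < a * b
      d<ab = x*x<y*y⇒x<y 0≤ab (<-respʳ-≈ (sym abab≈dd+DD) (x<x+y 0<DD))

    0<ab : 0# < D * D → 0# < a * b
    0<ab 0<DD = x*y#0⇒0<x 0≤ab (0<x⇒x#0 (<-respʳ-≈ (sym abab≈dd+DD)
      (<-≤-trans 0<DD (y≤x+y (x*x-nonNeg d)))))

  -- The circumradius formula.

  -- Cramer's rule expresses the centre w through u and v:
  -- 2Dw = (∣u∣²v₂ - ∣v∣²u₂ , ∣v∣²u₁ - ∣u∣²v₁).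
  circumradius-vectors : ∀ u v w →
    normSq u ≈ dot u w + dot u w → normSq v ≈ dot v w + dot v w →
    normSq u * normSq v * normSq (v -ₚ u)
      ≈ normSq w * ((cross u v + cross u v) * (cross u v + cross u v))
  circumradius-vectors u@(u₁ , u₂) v@(v₁ , v₂) w@(w₁ , w₂) hu hv = begin-equality
    normSq u * normSq v * normSq (v -ₚ u)
      -- In `X² + Y²` the square terms give `U²V + V²U` and the mixed terms give `-2UV(u·v)`;
      -- together this is `UV` times `normSq (v -ₚ u)`.
      ≈⟨ solve 4 (λ u₁ u₂ v₁ v₂ →
           let U = u₁ :* u₁ :+ u₂ :* u₂
               V = v₁ :* v₁ :+ v₂ :* v₂
               X = U :* v₂ :- V :* u₂
               Y = V :* u₁ :- U :* v₁
           in U :* V :* ((v₁ :- u₁) :* (v₁ :- u₁) :+ (v₂ :- u₂) :* (v₂ :- u₂))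
                := X :* X :+ Y :* Y)
           refl u₁ u₂ v₁ v₂ ⟩
    (U * v₂ - V * u₂) * (U * v₂ - V * u₂) + (V * u₁ - U * v₁) * (V * u₁ - U * v₁)
      ≈⟨ +-cong (*-cong cramer₁ cramer₁) (*-cong cramer₂ cramer₂) ⟩
    (2D * w₁) * (2D * w₁) + (2D * w₂) * (2D * w₂)
      ≈⟨ solve 3 (λ t w₁ w₂ → (t :* w₁) :* (t :* w₁) :+ (t :* w₂) :* (t :* w₂)
                    := (w₁ :* w₁ :+ w₂ :* w₂) :* (t :* t)) refl 2D w₁ w₂ ⟩
    normSq w * (2D * 2D) ∎
    where
    U V 2D : Carrier
    U  = normSq u
    V  = normSq v
    2D = cross u v + cross u v

    cramer₁ : U * v₂ - V * u₂ ≈ 2D * w₁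
    cramer₁ = trans (+-cong (*-congʳ hu) (-‿cong (*-congʳ hv)))
      (solve 6 (λ u₁ u₂ v₁ v₂ w₁ w₂ →
        let uw = u₁ :* w₁ :+ u₂ :* w₂
            vw = v₁ :* w₁ :+ v₂ :* w₂
            D  = u₁ :* v₂ :- v₁ :* u₂
        in (uw :+ uw) :* v₂ :- (vw :+ vw) :* u₂ := (D :+ D) :* w₁)
        refl u₁ u₂ v₁ v₂ w₁ w₂)

    cramer₂ : V * u₁ - U * v₁ ≈ 2D * w₂
    cramer₂ = trans (+-cong (*-congʳ hv) (-‿cong (*-congʳ hu)))
      (solve 6 (λ u₁ u₂ v₁ v₂ w₁ w₂ →
        let uw = u₁ :* w₁ :+ u₂ :* w₂
            vw = v₁ :* w₁ :+ v₂ :* w₂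
            D  = u₁ :* v₂ :- v₁ :* u₂
        in (vw :+ vw) :* u₁ :- (uw :+ uw) :* v₁ := (D :+ D) :* w₂)
        refl u₁ u₂ v₁ v₂ w₁ w₂)

  -- Since `q -ₚ o` is the difference of `p -ₚ o` and `p -ₚ q`, expanding its norm leaves a linear
  -- equation for `o`, the perpendicular bisector of the chord. Two such equations are the input of
  -- Cramer's rule.
  equidistant⇒chord : ∀ p q o → normSq (p -ₚ o) ≈ normSq (q -ₚ o) →
    normSq (p -ₚ q) ≈ dot (p -ₚ q) (p -ₚ o) + dot (p -ₚ q) (p -ₚ o)
  equidistant⇒chord p@(p₁ , p₂) q@(q₁ , q₂) o@(o₁ , o₂) po≈qo = begin-equality
    normSq (p -ₚ q)
      ≈⟨ solve 6 (λ p₁ p₂ q₁ q₂ o₁ o₂ →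
           let dt = (p₁ :- q₁) :* (p₁ :- o₁) :+ (p₂ :- q₂) :* (p₂ :- o₂)
               sq = λ a b → a :* a :+ b :* b
           in sq (p₁ :- q₁) (p₂ :- q₂)
                := (dt :+ dt) :+ (sq (q₁ :- o₁) (q₂ :- o₂) :- sq (p₁ :- o₁) (p₂ :- o₂)))
           refl p₁ p₂ q₁ q₂ o₁ o₂ ⟩
    (e + e) + (normSq (q -ₚ o) - normSq (p -ₚ o))
      ≈⟨ +-congˡ (+-congʳ (sym po≈qo)) ⟩
    (e + e) + (normSq (p -ₚ o) - normSq (p -ₚ o))
      ≈⟨ +-congˡ (-‿inverseʳ _) ⟩
    (e + e) + 0#
      ≈⟨ +-identityʳ _ ⟩
    e + e ∎
    where
    e : Carrier
    e = dot (p -ₚ q) (p -ₚ o)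

  -- As `D + D` is four times the signed area, this is `abc = 4 R Area` squared. Squaring turns the
  -- distances into polynomials and removes the absolute value.
  circumradius : ∀ p q r (K : Circle) → p ∈ₖ K → q ∈ₖ K → r ∈ₖ K →
    let open Triangle p q r
        R = value (radius K)
    in (a * b * c′) * (a * b * c′) ≈ (R * R) * ((D + D) * (D + D))
  circumradius p@(p₁ , p₂) q@(q₁ , q₂) r@(r₁ , r₂) K p∈ q∈ r∈ = begin-equality
    (a * b * c′) * (a * b * c′)
      ≈⟨ solve 3 (λ a b c → (a :* b :* c) :* (a :* b :* c) := (a :* a) :* (c :* c) :* (b :* b))
           refl a b c′ ⟩
    (a * a) * (c′ * c′) * (b * b)
      ≈⟨ *-cong (*-cong (dist*dist p q) (dist*dist p r)) (trans (dist*dist q r) edge) ⟩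
    normSq (p -ₚ q) * normSq (p -ₚ r) * normSq ((p -ₚ r) -ₚ (p -ₚ q))
      ≈⟨ circumradius-vectors (p -ₚ q) (p -ₚ r) (p -ₚ o)
           (equidistant⇒chord p q o (trans (onK p∈) (sym (onK q∈))))
           (equidistant⇒chord p r o (trans (onK p∈) (sym (onK r∈)))) ⟩
    normSq (p -ₚ o) * ((D′ + D′) * (D′ + D′))
      ≈⟨ *-cong (onK p∈) (*-cong (+-cong D′≈D D′≈D) (+-cong D′≈D D′≈D)) ⟩
    (R * R) * ((D + D) * (D + D)) ∎
    where
    open Triangle p q r
    o : Point
    o = centre K

    R D′ : Carrier
    R  = value (radius K)
    D′ = cross (p -ₚ q) (p -ₚ r)

    onK : ∀ {s} → s ∈ₖ K → normSq (s -ₚ o) ≈ R * R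
    onK {s} s∈ = trans (sym (dist*dist s o)) (*-cong s∈ s∈)

    edge : normSq (q -ₚ r) ≈ normSq ((p -ₚ r) -ₚ (p -ₚ q))
    edge = sym (+-cong (*-cong (lin p₁ q₁ r₁) (lin p₁ q₁ r₁)) (*-cong (lin p₂ q₂ r₂) (lin p₂ q₂ r₂)))
      where
      lin : ∀ x y z → (x - z) - (x - y) ≈ y - z
      lin = solve 3 (λ x y z → (x :- z) :- (x :- y) := y :- z) refl

    D′≈D : D′ ≈ D
    D′≈D = solve 6 (λ p₁ p₂ q₁ q₂ r₁ r₂ →
      (p₁ :- q₁) :* (p₂ :- r₂) :- (p₁ :- r₁) :* (p₂ :- q₂)
        := (q₁ :- p₁) :* (r₂ :- p₂) :- (r₁ :- p₁) :* (q₂ :- p₂))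
      refl p₁ p₂ q₁ q₂ r₁ r₂

  -- The lower bound for two consecutive edges.

  ∛-value : ∀ x → value (∛ x) ^ 3 ≈ value x
  ∛-value x = proj₂ (proj₂ (nthRoot 3 (value x) (<⇒≤ (positive x))))

  -- Cubes are compared: `(2k)³ = 8A₀R₀ ≤ 4abc < 4ab(a + b) ≤ (a + b)³`.
  2∛<twoEdges : ∀ p q r (A₀ R₀ : ℝ₊) →
    value A₀ / 2₊ ≤ triangleArea p q r →
    ∃[ K ] (value R₀ ≤ value (radius K) × p ∈ₖ K × q ∈ₖ K × r ∈ₖ K) →
    value (∛ (A₀ *₊ R₀)) + value (∛ (A₀ *₊ R₀)) < dist p q + dist q r
  2∛<twoEdges p q r A₀ R₀ area (K , R₀≤R , p∈ , q∈ , r∈) =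
    ^-cancel-< 3 (+-nonNeg 0≤k 0≤k) 0≤a+b (begin-strict
      (k + k) ^ 3
        -- A cube unfolds to a product ending in `1#`, which the solver carries as the variable `o`.
        ≈⟨ solve 2 (λ k o →
             let t = k :+ k
                 z = k :* (k :* (k :* o))
             in t :* (t :* (t :* o)) := (z :+ z) :+ (z :+ z) :+ ((z :+ z) :+ (z :+ z)))
             refl k 1# ⟩
      4* (k ^ 3 + k ^ 3)
        ≈⟨ +-cong (+-cong 2k³≈2AR 2k³≈2AR) (+-cong 2k³≈2AR 2k³≈2AR) ⟩
      4* (A * R′ + A * R′)
        ≤⟨ +-mono-≤ (+-mono-≤ 2AR≤abc 2AR≤abc) (+-mono-≤ 2AR≤abc 2AR≤abc) ⟩
      4* (a * b * c′)
        <⟨ +-mono-< (+-mono-< abc<ab[a+b] abc<ab[a+b]) (+-mono-< abc<ab[a+b] abc<ab[a+b]) ⟩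
      4* (a * b * (a + b))
        -- The added term is `(a - b)²`, the slack in `4ab ≤ (a + b)²`, multiplied by `a + b`.
        ≤⟨ x≤x+y (*-nonNeg 0≤a+b (x*x-nonNeg (a - b))) ⟩
      4* (a * b * (a + b)) + (a + b) * ((a - b) * (a - b))
        ≈⟨ solve 2 (λ a b →
             let z = a :* b :* (a :+ b)
             in (z :+ z) :+ (z :+ z) :+ (a :+ b) :* ((a :- b) :* (a :- b))
                  := (a :+ b) :* ((a :+ b) :* (a :+ b)))
             refl a b ⟩
      (a + b) * ((a + b) * (a + b))
        ≈⟨ *-congˡ (*-congˡ (*-identityʳ (a + b))) ⟨
      (a + b) ^ 3 ∎)
    where
    open Triangle p q r

    A R′ R k : Carrier
    A  = value A₀
    R′ = value R₀
    R  = value (radius K)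
    k  = value (∛ (A₀ *₊ R₀))

    0≤A : 0# ≤ A
    0≤A = <⇒≤ (positive A₀)

    0≤R′ : 0# ≤ R′
    0≤R′ = <⇒≤ (positive R₀)

    0≤k : 0# ≤ k
    0≤k = <⇒≤ (positive (∛ (A₀ *₊ R₀)))

    4* : Carrier → Carrier
    4* x = (x + x) + (x + x)

    2k³≈2AR : k ^ 3 + k ^ 3 ≈ A * R′ + A * R′
    2k³≈2AR = +-cong (∛-value (A₀ *₊ R₀)) (∛-value (A₀ *₊ R₀))

    A≤∣D∣ : A ≤ ∣ D ∣
    -- Both sides of `area` carry the same factor one half, so `∣ D ∣ < A` would contradict it after
    -- halving.
    A≤∣D∣ ∣D∣<A = area (*-monoˡ-< (recip-pos _ (positive 2₊)) ∣D∣<A)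

    AA≤DD : A * A ≤ D * D
    AA≤DD = y≤∣x∣⇒y*y≤x*x 0≤A A≤∣D∣

    0<DD : 0# < D * D
    0<DD = <-≤-trans (*-pos (positive A₀) (positive A₀)) AA≤DD

    RR-mono : R′ * R′ ≤ R * R
    RR-mono = ≤-trans (*-monoʳ-≤ 0≤R′ R₀≤R) (*-monoˡ-≤ (≤-trans 0≤R′ R₀≤R) R₀≤R)

    2AR≤abc : A * R′ + A * R′ ≤ a * b * c′
    -- The circumradius formula is available for squares, so the bounds on area and radius enter
    -- squared as well.
    2AR≤abc = x*x≤y*y⇒x≤y (*-nonNeg 0≤ab 0≤c) (begin
      (A * R′ + A * R′) * (A * R′ + A * R′)
        ≈⟨ solve 2 (λ A R → (A :* R :+ A :* R) :* (A :* R :+ A :* R)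
             := R :* R :* ((A :* A :+ A :* A) :+ (A :* A :+ A :* A))) refl A R′ ⟩
      R′ * R′ * 4* (A * A)
        ≤⟨ *-monoʳ-≤ (x*x-nonNeg R′) (+-mono-≤ 2AA≤2DD 2AA≤2DD) ⟩
      R′ * R′ * 4* (D * D)
        ≤⟨ *-monoˡ-≤ (+-nonNeg 0≤2DD 0≤2DD) RR-mono ⟩
      R * R * 4* (D * D)
        ≈⟨ solve 2 (λ R D → R :* R :* ((D :* D :+ D :* D) :+ (D :* D :+ D :* D))
             := R :* R :* ((D :+ D) :* (D :+ D))) refl R D ⟩
      (R * R) * ((D + D) * (D + D))
        ≈⟨ circumradius p q r K p∈ q∈ r∈ ⟨
      (a * b * c′) * (a * b * c′) ∎)
      where
      2AA≤2DD : A * A + A * A ≤ D * D + D * D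
      2AA≤2DD = +-mono-≤ AA≤DD AA≤DD
      0≤2DD : 0# ≤ D * D + D * D
      0≤2DD = +-nonNeg (x*x-nonNeg D) (x*x-nonNeg D)

    abc<ab[a+b] : a * b * c′ < a * b * (a + b)
    abc<ab[a+b] = *-monoʳ-< (0<ab 0<DD) (c<a+b 0<DD)

module ClosedPolygons {c ℓ₁ ℓ₂} (ℝ : RealNumbers c ℓ₁ ℓ₂) where

  open RealNumbers ℝ
  open RealProperties ℝ
  open Plane ℝ
  open ≤-Reasoning
  open PlaneGeometry ℝ
  open CommutativeRing commutativeRing using (+-commutativeMonoid)
  open Sum +-commutativeMonoid using (sum; sum-cong-≋; sum-init-last; sum-permute; sum-replicate; ∑-distrib-+)
  open Mult semiring using (×-assoc-*; ×-congʳ) renaming (_×_ to _·_)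

  -- Finite sums.

  sum-mono-≤ : ∀ {n} {f g : Fin n → Carrier} → (∀ i → f i ≤ g i) → sum f ≤ sum g
  sum-mono-≤ {zero}  f≤g = ≤-refl
  sum-mono-≤ {suc n} f≤g = +-mono-≤ (f≤g Fin.zero) (sum-mono-≤ (f≤g ∘ Fin.suc))

  sum-mono-< : ∀ {n} {f g : Fin (suc n) → Carrier} → (∀ i → f i < g i) → sum f < sum g
  sum-mono-< f<g = +-mono-<-≤ (f<g Fin.zero) (sum-mono-≤ (λ i → <⇒≤ (f<g (Fin.suc i))))

  sum-const : ∀ n x → sum {n} (λ _ → x) ≈ fromℕ# n * x
  sum-const n x = begin-equality
    sum {n} (λ _ → x)  ≈⟨ sum-replicate n ⟩
    n · x              ≈⟨ ×-congʳ n (*-identityˡ x) ⟨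
    n · (1# * x)       ≈⟨ ×-assoc-* n 1# x ⟨
    fromℕ# n * x       ∎

  -- Splitting off the last term on the left gives the missing first term on the right. Applied to
  -- edge lengths, this shows that every edge is counted twice.
  sum-rotate : ∀ n (f : ℕ → Carrier) → f (suc n) ≈ f 0 →
    sum {suc n} (λ i → f (suc (toℕ i))) ≈ sum {suc n} (λ i → f (toℕ i))
  sum-rotate n f f[1+n]≈f0 = begin-equality
    sum {suc n} (λ i → f (suc (toℕ i)))
      ≈⟨ sum-init-last (λ i → f (suc (toℕ i))) ⟩
    sum {n} (λ i → f (suc (toℕ (inject₁ i)))) + f (suc (toℕ (fromℕ n)))
      ≈⟨ +-cong (sum-cong-≋ {n} (λ i → reflexive (≡.cong (f ∘ suc) (Fin.toℕ-inject₁ i))))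
                (trans (reflexive (≡.cong (f ∘ suc) (Fin.toℕ-fromℕ n))) f[1+n]≈f0) ⟩
    sum {n} (λ i → f (suc (toℕ i))) + f 0
      ≈⟨ +-comm _ _ ⟩
    sum {suc n} (λ i → f (toℕ i)) ∎

  -- Perimeters of closed polygons.

  pathLength : ∀ {n} → (Fin (suc n) → Point) → Carrier
  pathLength p = sum (λ i → dist (p (inject₁ i)) (p (Fin.suc i)))

  perimeter : ∀ {n} → (Fin (suc n) → Point) → Carrier
  perimeter {n} p = pathLength p + dist (p (fromℕ n)) (p Fin.zero)

  perimeter-cong : ∀ {n} {p q : Fin (suc n) → Point} → (∀ i → p i ≈ₚ q i) → perimeter p ≈ perimeter q
  perimeter-cong {n} p≈q = +-cong
    (sum-cong-≋ {n} (λ i → dist-cong (p≈q (inject₁ i)) (p≈q (Fin.suc i))))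
    (dist-cong (p≈q (fromℕ n)) (p≈q Fin.zero))

  -- Serves the case of decreasing parameters. Reversal permutes the edges of the path, and the
  -- closing edge only has its ends exchanged.
  perimeter-opposite : ∀ {n} (p : Fin (suc n) → Point) → perimeter (p ∘ opposite) ≈ perimeter p
  perimeter-opposite {n} p = +-cong
    (begin-equality
      sum {n} (λ i → dist (p (opposite (inject₁ i))) (p (inject₁ (opposite i))))
        ≈⟨ sum-cong-≋ {n} (λ i → trans
             (reflexive (≡.cong (λ j → dist (p j) (p (inject₁ (opposite i)))) (opposite-inject₁ i)))
             (dist-sym _ _)) ⟩
      sum {n} (λ i → dist (p (inject₁ (opposite i))) (p (Fin.suc (opposite i))))
        ≈⟨ sum-permute {n} (λ i → dist (p (inject₁ i)) (p (Fin.suc i))) Perm.reverse ⟨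
      pathLength p ∎)
    (trans (reflexive (≡.cong (λ j → dist (p j) (p (fromℕ n))) (opposite-fromℕ n))) (dist-sym _ _))

  -- Once `Q` wraps around, the closing edge is the last term of a uniform sum, to which
  -- `sum-rotate` applies.
  perimeter-ℕ : ∀ n (Q : ℕ → Point) → Q (suc n) ≡ Q 0 →
    perimeter {n} (Q ∘ toℕ) ≈ sum {suc n} (λ i → dist (Q (toℕ i)) (Q (suc (toℕ i))))
  perimeter-ℕ n Q Q[1+n]≡Q0 = sym (begin-equality
    sum {suc n} (λ i → dist (Q (toℕ i)) (Q (suc (toℕ i))))
      ≈⟨ sum-init-last (λ i → dist (Q (toℕ i)) (Q (suc (toℕ i)))) ⟩
    sum {n} (λ i → dist (Q (toℕ (inject₁ i))) (Q (suc (toℕ (inject₁ i))))) + dist (Q m) (Q (suc m))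
      ≈⟨ +-cong
           (sum-cong-≋ {n} (λ i → reflexive
             (≡.cong (λ j → dist (Q (toℕ (inject₁ i))) (Q (suc j))) (Fin.toℕ-inject₁ i))))
           (reflexive (≡.cong (dist (Q m))
             (≡.trans (≡.cong (Q ∘ suc) (Fin.toℕ-fromℕ n)) Q[1+n]≡Q0))) ⟩
    perimeter {n} (Q ∘ toℕ) ∎)
    where
    m : ℕ
    m = toℕ (fromℕ n)

  pathLength-∷ʳ : ∀ {a} {A : Set a} (γ : A → Point) {n} (x : Fin (suc n) → A) y →
    pathLength (γ ∘ (x ∷ʳ y)) ≈ pathLength (γ ∘ x) + dist (γ (x (fromℕ n))) (γ y)
  pathLength-∷ʳ γ {zero}  x y = +-comm _ _
  pathLength-∷ʳ γ {suc n} x y = trans (+-congˡ (pathLength-∷ʳ γ (x ∘ Fin.suc) y)) (sym (+-assoc _ _ _))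

  -- Polygons inscribed in a closed curve.

  module _ (C : ClosedCurve) where

    open ClosedCurve C

    -- Inserting the vertex γ 0 = γ 1 into the closing edge does not shorten the polygon.
    perimeter≤length : ∀ {n L} → (∀ π → inscribedLength C π ≤ L) →
      (x : Fin (suc n) → UnitInterval) → Adjacent _≤_ (coord ∘ x) → perimeter (γ ∘ x) ≤ L
    perimeter≤length {n} {L} bound x mono = begin
      ℓ + dist xₙ x₀
        ≤⟨ +-monoʳ-≤ ℓ (Triangle.c≤a+b xₙ (γ 1ᴵ) x₀) ⟩
      ℓ + (dist xₙ (γ 1ᴵ) + dist (γ 1ᴵ) x₀)
        ≈⟨ +-assoc _ _ _ ⟨
      ℓ + dist xₙ (γ 1ᴵ) + dist (γ 1ᴵ) x₀
        ≈⟨ +-comm _ _ ⟩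
      dist (γ 1ᴵ) x₀ + (ℓ + dist xₙ (γ 1ᴵ))
        ≈⟨ +-cong (dist-cong (sym (proj₁ closed) , sym (proj₂ closed)) (refl , refl))
                  (sym (pathLength-∷ʳ γ x 1ᴵ)) ⟩
      dist (γ 0ᴵ) x₀ + pathLength (γ ∘ (x ∷ʳ 1ᴵ))
        ≤⟨ bound π ⟩
      L ∎
      where
      ℓ : Carrier
      ℓ = pathLength (γ ∘ x)

      x₀ xₙ : Point
      x₀ = γ (x Fin.zero)
      xₙ = γ (x (fromℕ n))

      node : Fin (suc (suc (suc n))) → UnitInterval
      node Fin.zero    = 0ᴵ
      node (Fin.suc i) = (x ∷ʳ 1ᴵ) i

      node-mono : Adjacent (λ s t → coord s ≤ coord t) node
      node-mono Fin.zero    = 0≤coord (x Fin.zero)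
      node-mono (Fin.suc i) = ∷ʳ-adjacent {_∼_ = λ s t → coord s ≤ coord t} x mono
        (coord≤1 (x (fromℕ n))) i

      π : Partition
      π = record
        -- The `n + 1` vertices and the two end points make `n + 3` nodes, hence `n + 2` intervals.
        -- The first may be degenerate, as `Partition` is only weakly monotone.
        { size  = suc (suc n)
        ; node  = node
        ; first = refl
        ; last  = reflexive (≡.cong coord (∷ʳ-last x 1ᴵ))
        ; mono  = node-mono
        }

    -- The polygon is read from the index at which its parameters become monotone; if they decrease,
    -- it is traversed backwards.
    cyclicPerimeter≤length : ∀ {n L} {P : Fin (suc n) → Point} → (∀ π → inscribedLength C π ≤ L) →
      (order : InCyclicOrder C P) →
      perimeter (λ j → P (j ⊕ proj₁ (InCyclicOrder.ordered order))) ≤ L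
    cyclicPerimeter≤length {n} {L} {P} bound order = begin
      perimeter (λ j → P (j ⊕ k))  ≈⟨ perimeter-cong (λ j → onCurve (j ⊕ k)) ⟩
      perimeter (γ ∘ x)            ≤⟨ helper (proj₂ ordered) ⟩
      L                            ∎
      where
      open InCyclicOrder order
      k : ℕ
      k = proj₁ ordered

      x : Fin (suc n) → UnitInterval
      x j = param (j ⊕ k)

      helper : Increasing (coord ∘ x) ⊎ Decreasing (coord ∘ x) → perimeter (γ ∘ x) ≤ L
      helper (inj₁ inc) = perimeter≤length {n} bound x (λ i → <⇒≤ (inc _ _ (inject₁<suc i)))
      helper (inj₂ dec) = begin
        perimeter (γ ∘ x)             ≈⟨ perimeter-opposite (γ ∘ x) ⟨
        perimeter (γ ∘ x ∘ opposite)  ≤⟨ perimeter≤length bound (x ∘ opposite) mono ⟩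
        L                             ∎
        where
        mono : Adjacent _≤_ (coord ∘ x ∘ opposite)
        mono i = ≡.subst (λ j → coord (x j) ≤ coord (x (inject₁ (opposite i))))
          (≡.sym (opposite-inject₁ i)) (<⇒≤ (dec _ _ (inject₁<suc (opposite i))))

  -- Summation once around the polygon.

  -- Each edge belongs to two of the summed inequalities, so the sum bounds twice the perimeter and
  -- the factor two is cancelled at the end.
  cyclicPolygon<length : (C : ClosedCurve) (n : ℕ) (P : Fin (suc n) → Point) →
    InCyclicOrder C P →
    (A₀ R₀ : ℝ₊) →
    (∀ j → value A₀ / 2₊ ≤ triangleArea (P j) (P (j ⊕ 1)) (P (j ⊕ 2))) →
    (∀ j → ∃[ K ] (value R₀ ≤ value (radius K) ×
                   P j ∈ₖ K × P (j ⊕ 1) ∈ₖ K × P (j ⊕ 2) ∈ₖ K)) →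
    ∀ L → (∀ π → inscribedLength C π ≤ L) →
    fromℕ# (suc n) * value (∛ (A₀ *₊ R₀)) < L
  cyclicPolygon<length C n P order A₀ R₀ area circle L bound = *-cancelʳ-< (positive 2₊) (begin-strict
    2# * (fromℕ# N * k)
      ≈⟨ trans (double (fromℕ# N * k)) (sym (distribˡ (fromℕ# N) k k)) ⟩
    fromℕ# N * (k + k)
      ≈⟨ sum-const N (k + k) ⟨
    sum {N} (λ _ → k + k)
      <⟨ sum-mono-< {n} (λ i → edges (toℕ i)) ⟩
    sum {N} (λ i → e (toℕ i) + e (suc (toℕ i)))
      ≈⟨ ∑-distrib-+ {N} (λ i → e (toℕ i)) (λ i → e (suc (toℕ i))) ⟩
    sum {N} (λ i → e (toℕ i)) + sum {N} (λ i → e (suc (toℕ i)))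
      -- Both end points of edge `N` wrap around, to `Q 0` and `Q 1`, so `e N` equals `e 0`.
      ≈⟨ +-congˡ (sum-rotate n e (reflexive (≡.cong₂ dist (period 0) (period 1)))) ⟩
    sum {N} (λ i → e (toℕ i)) + sum {N} (λ i → e (toℕ i))
      ≈⟨ +-cong (perimeter-ℕ n Q (period 0)) (perimeter-ℕ n Q (period 0)) ⟨
    perimeter {n} (Q ∘ toℕ) + perimeter {n} (Q ∘ toℕ)
      -- By definition `Q ∘ toℕ` is the polygon `P (j ⊕ s)` of the cyclic order.
      ≤⟨ +-mono-≤ (cyclicPerimeter≤length C bound order) (cyclicPerimeter≤length C bound order) ⟩
    L + L
      ≈⟨ double L ⟨
    2# * L ∎)
    where
    N : ℕ
    N = suc n

    2# k : Carrier
    2# = value 2₊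
    k  = value (∛ (A₀ *₊ R₀))

    double : ∀ x → 2# * x ≈ x + x
    double x = trans (distribʳ x 1# 1#) (+-cong (*-identityˡ x) (*-identityˡ x))

    s : ℕ
    s = proj₁ (InCyclicOrder.ordered order)

    -- Unrolls the polygon periodically from its starting index `s`, so that the next vertex is
    -- given by `suc`.
    Q : ℕ → Point
    Q i = P ((i ℕ.+ s) mod N)

    e : ℕ → Carrier
    e i = dist (Q i) (Q (suc i))

    period : ∀ i → Q (i ℕ.+ N) ≡ Q i
    period i = ≡.cong P (mod-cong (i ℕ.+ N ℕ.+ s) (i ℕ.+ s) N (≡.trans
      (≡.cong (_% N) (≡.trans (ℕ.+-assoc i N s)
        (≡.trans (≡.cong (i ℕ.+_) (ℕ.+-comm N s)) (≡.sym (ℕ.+-assoc i s N)))))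
      ([m+n]%n≡m%n (i ℕ.+ s) N)))

    edges : ∀ i → k + k < e i + e (suc i)
    edges i = 2∛<twoEdges (Q i) (Q (1 ℕ.+ i)) (Q (2 ℕ.+ i)) A₀ R₀
      (≡.subst₂ (λ q r → value A₀ / 2₊ ≤ triangleArea (Q i) q r) (next 1) (next 2) (area j))
      (≡.subst₂ (λ q r → ∃[ K ] (value R₀ ≤ value (radius K) × Q i ∈ₖ K × q ∈ₖ K × r ∈ₖ K))
        (next 1) (next 2) (circle j))
      where
      j : Fin N
      j = (i ℕ.+ s) mod N

      next : ∀ l → P (j ⊕ l) ≡ P ((l ℕ.+ (i ℕ.+ s)) mod N)
      next l = ≡.cong P (toℕ-mod-+-mod (i ℕ.+ s) l N)

-- Division by the cube root, for finite and infinite length.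

theorem3p2 : ∀ {c ℓ₁ ℓ₂} (ℝ : RealNumbers c ℓ₁ ℓ₂) →
    let open RealNumbers ℝ
        open Plane ℝ
    in (C : ClosedCurve) (N : ℕ) .{{_ : NonZero N}} (P : Fin N → Point) →
       Distinct P →
       InCyclicOrder C P →
       (A₀ R₀ : ℝ₊) →
       (∀ j → value A₀ / 2₊ ≤ triangleArea (P j) (P (j ⊕ 1)) (P (j ⊕ 2))) →
       (∀ j → ∃[ K ] (value R₀ ≤ value (radius K) ×
                      P j ∈ₖ K × P (j ⊕ 1) ∈ₖ K × P (j ⊕ 2) ∈ₖ K)) →
       (ℓ : ℝ∞) → IsLength C ℓ →
       fromℕ# N <∞ ℓ /∞ ∛ (A₀ *₊ R₀)
theorem3p2 ℝ C zero P _ _ _ _ _ _ _ _ = contradiction ≡.refl (ℕ.≢-nonZero⁻¹ zero)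
-- For infinite length the claim reduces to the unit type.
theorem3p2 ℝ C (suc n) P _ order A₀ R₀ area circle Plane.∞ _ = _
theorem3p2 ℝ C (suc n) P _ order A₀ R₀ area circle (Plane.fin L) (bound , _) = begin-strict
  fromℕ# N                       ≈⟨ *-identityʳ _ ⟨
  fromℕ# N * 1#                  ≈⟨ *-congˡ (x*recip≈1 k (positive κ)) ⟨
  fromℕ# N * (k * r)             ≈⟨ *-assoc _ _ _ ⟨
  fromℕ# N * k * r               <⟨ *-monoˡ-< (recip-pos k (positive κ))
                                      (cyclicPolygon<length C n P order A₀ R₀ area circle L bound) ⟩
  L * r                          ∎
  where
  open RealNumbers ℝ
  open RealProperties ℝ
  open Plane ℝ
  open ≤-Reasoning
  open ClosedPolygons ℝ
  N : ℕ
  N = suc n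
  κ : ℝ₊
  κ = ∛ (A₀ *₊ R₀)
  k r : Carrier
  k = value κ
  r = recip k (positive κ)
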